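{- Let $\varepsilon\in\{+,-\}$ and let $L$ be an integral lattice such that some fine symbol for $L$ has a term $1^{\varepsilon2}_{\rm II}$. Then for any fine symbol $F$ for $L$, there is a finite sequence of sign walking, giver permutation and giver conversion operations transforming $F$ into a fine symbol having a term $1^{\varepsilon2}_{\rm II}$.
   Context: $\mathbb{Z}_2$ denotes the $2$-adic integers and $\mathbb{Q}_2$ its fraction field. A lattice is a finitely generated free $\mathbb{Z}_2$-module with a nondegenerate symmetric bilinear form valued in $\mathbb{Q}_2$; it is integral if all inner products lie in $\mathbb{Z}_2$. $\langle a_1,\dots,a_n\rangle$ is the lattice with diagonal Gram matrix $\mathrm{diag}(a_1,\dots,a_n)$. For $q$ a power of $2$ (possibly with negative exponent) define the following "terms" with scale $q$: $q^{+2}_{\rm II}$ is the lattice with Gram matrix $q\begin{pmatrix}0&1\\1&0\end{pmatrix}$ and $q^{ -2}_{\rm II}$ the lattice with Gram matrix $q\begin{pmatrix}2&1\\1&2\end{pmatrix}$ (type II); $q^{+}_G=\langle q\rangle$, $q^-_G=\langle -3q\rangle$ (givers), $q^+_R=\langle -q\rangle$, $q^-_R=\langle 3q\rangle$ (receivers); givers and receivers have type I. The superscript $\pm$ is the sign of the term; the subscript $G$ or $R$ is its label. A fine decomposition of a lattice is an orthogonal direct sum decomposition each of whose summands is isometric to one of these terms, such that a summand $q^{\pm2}_{\rm II}$ occurs only if every summand of scale $q$ has type II; the corresponding unordered list of terms is a fine symbol for the lattice. A compartment of a fine symbol is a maximal set of its type I terms whose set of scales is of the form $\{2^a,2^{a+1},\dots,2^b\}$.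 The operations are: Sign walking: choose two terms satisfying one of (0) same scale; (1) scales differ by a factor $2$ and one has type I, the other type II; (2) scales differ by a factor $2$ and both are givers or both are receivers; (3) scales differ by a factor $4$ and both have type I; then negate the signs of both terms (keeping scales), and in case (2) also change both from givers to receivers or vice versa (in the other cases keeping the labels). Giver permutation: within one compartment, permute the labels $G,R$ among its terms, keeping scales and signs. Giver conversion: within one compartment, change four terms labelled $G$ to label $R$, or four labelled $R$ to label $G$, keeping scales and signs. These operations applied to a fine symbol for $L$ yield fine symbols representing lattices isometric to $L$. -}

module Defs where

open import Data.Nat as ℕ using (ℕ; zero; suc; _≤_)
open import Data.Integer as ℤ using (ℤ; +_)
open import Data.Integer.Solver using (module +-*-Solver)
open import Data.Bool using (Bool; true; false; if_then_else_; _∨_)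
open import Data.Product using (Σ; Σ-syntax; ∃; ∃-syntax; _×_; _,_)
open import Data.Sum using (_⊎_)
open import Data.Fin as Fin using (Fin; splitAt)
open import Data.Fin.Subset using (Subset; _∈_; _⊆_; ∣_∣)
open import Data.Fin.Permutation using (Permutation′; _⟨$⟩ʳ_)
open import Data.Vec using (lookup)
open import Data.List as List using (List; []; _∷_; length)
open import Data.Sign using (Sign) renaming (opposite to flipSign)
open import Relation.Nullary using (¬_; does)
open import Relation.Binary.PropositionalEquality
open import Relation.Binary.Construct.Closure.ReflexiveTransitive using (Star)

------------------------------------------------------------------------
-- The 2-adic integers ℤ₂ = lim ℤ/2^k, as coherent sequences of integers
------------------------------------------------------------------------

-- a ≡ b (mod 2^k)
_≡[mod2^_]_ : ℤ → ℕ → ℤ → Set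
a ≡[mod2^ k ] b = Σ ℤ λ q → a ℤ.- b ≡ q ℤ.* (+ (2 ℕ.^ k))

record ℤ₂ : Set where
  constructor mkℤ₂
  field
    approx   : ℕ → ℤ                       -- approx k is the residue mod 2^k
    coherent : ∀ k → approx (suc k) ≡[mod2^ k ] approx k
open ℤ₂ public

-- equality of 2-adic integers
infix 4 _≈_
_≈_ : ℤ₂ → ℤ₂ → Set
x ≈ y = ∀ k → approx x k ≡[mod2^ k ] approx y k

private
  open +-*-Solver

  +-cong-mod : ∀ {k a b c d} → a ≡[mod2^ k ] b → c ≡[mod2^ k ] d →
               (a ℤ.+ c) ≡[mod2^ k ] (b ℤ.+ d)
  +-cong-mod {k} {a} {b} {c} {d} (q₁ , p₁) (q₂ , p₂) = q₁ ℤ.+ q₂ , (begin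
      (a ℤ.+ c) ℤ.- (b ℤ.+ d)
        ≡⟨ solve 4 (λ a b c d → (a :+ c) :- (b :+ d) := (a :- b) :+ (c :- d)) refl a b c d ⟩
      (a ℤ.- b) ℤ.+ (c ℤ.- d)
        ≡⟨ cong₂ ℤ._+_ p₁ p₂ ⟩
      q₁ ℤ.* m ℤ.+ q₂ ℤ.* m
        ≡⟨ solve 3 (λ x y m → x :* m :+ y :* m := (x :+ y) :* m) refl q₁ q₂ m ⟩
      (q₁ ℤ.+ q₂) ℤ.* m ∎)
    where open ≡-Reasoning
          m = + (2 ℕ.^ k)

  *-cong-mod : ∀ {k a b c d} → a ≡[mod2^ k ] b → c ≡[mod2^ k ] d →
               (a ℤ.* c) ≡[mod2^ k ] (b ℤ.* d)
  *-cong-mod {k} {a} {b} {c} {d} (q₁ , p₁) (q₂ , p₂) = a ℤ.* q₂ ℤ.+ q₁ ℤ.* d , (begin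
      (a ℤ.* c) ℤ.- (b ℤ.* d)
        ≡⟨ solve 4 (λ a b c d → (a :* c) :- (b :* d) := a :* (c :- d) :+ (a :- b) :* d) refl a b c d ⟩
      a ℤ.* (c ℤ.- d) ℤ.+ (a ℤ.- b) ℤ.* d
        ≡⟨ cong₂ (λ u v → a ℤ.* u ℤ.+ v ℤ.* d) p₂ p₁ ⟩
      a ℤ.* (q₂ ℤ.* m) ℤ.+ (q₁ ℤ.* m) ℤ.* d
        ≡⟨ solve 5 (λ a d x y m → a :* (y :* m) :+ (x :* m) :* d := (a :* y :+ x :* d) :* m) refl a d q₁ q₂ m ⟩
      (a ℤ.* q₂ ℤ.+ q₁ ℤ.* d) ℤ.* m ∎)
    where open ≡-Reasoning
          m = + (2 ℕ.^ k)

  refl-mod : ∀ {k} a → a ≡[mod2^ k ] a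
  refl-mod {k} a = ℤ.0ℤ , solve 2 (λ a m → a :- a := con ℤ.0ℤ :* m) refl a (+ (2 ℕ.^ k))

infixl 6 _+₂_
infixl 7 _*₂_

_+₂_ : ℤ₂ → ℤ₂ → ℤ₂
x +₂ y = mkℤ₂ (λ k → approx x k ℤ.+ approx y k)
              (λ k → +-cong-mod {k} {approx x (suc k)} {approx x k} {approx y (suc k)} {approx y k} (coherent x k) (coherent y k))

_*₂_ : ℤ₂ → ℤ₂ → ℤ₂
x *₂ y = mkℤ₂ (λ k → approx x k ℤ.* approx y k)
              (λ k → *-cong-mod {k} {approx x (suc k)} {approx x k} {approx y (suc k)} {approx y k} (coherent x k) (coherent y k))

-- the canonical embedding ℤ → ℤ₂
ι : ℤ → ℤ₂
ι z = mkℤ₂ (λ _ → z) (λ k → refl-mod {k} z)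

0₂ 1₂ : ℤ₂
0₂ = ι ℤ.0ℤ
1₂ = ι ℤ.1ℤ

------------------------------------------------------------------------
-- Matrices over ℤ₂
------------------------------------------------------------------------

Mat : ℕ → ℕ → Set
Mat m n = Fin m → Fin n → ℤ₂

∑ : ∀ {n} → (Fin n → ℤ₂) → ℤ₂
∑ {zero}  f = 0₂
∑ {suc n} f = f Fin.zero +₂ ∑ (λ i → f (Fin.suc i))

infixl 7 _⊗_
_⊗_ : ∀ {l m n} → Mat l m → Mat m n → Mat l n
(A ⊗ B) i j = ∑ λ k → A i k *₂ B k j

_ᵀ : ∀ {m n} → Mat m n → Mat n m
(A ᵀ) i j = A j i

𝟙 : ∀ {n} → Mat n n
𝟙 i j = if does (i Fin.≟ j) then 1₂ else 0₂

infix 4 _≈ₘ_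
_≈ₘ_ : ∀ {m n} → Mat m n → Mat m n → Set
A ≈ₘ B = ∀ i j → A i j ≈ B i j

-- orthogonal (block diagonal) sum of Gram matrices
_⊕_ : ∀ {m n} → Mat m m → Mat n n → Mat (m ℕ.+ n) (m ℕ.+ n)
_⊕_ {m} {n} A B i j with splitAt m i | splitAt m j
... | Data.Sum.inj₁ i′ | Data.Sum.inj₁ j′ = A i′ j′
... | Data.Sum.inj₂ i′ | Data.Sum.inj₂ j′ = B i′ j′
... | _ | _ = 0₂

------------------------------------------------------------------------
-- Integral ℤ₂-lattices (given by a Gram matrix w.r.t. a basis)
------------------------------------------------------------------------

record IntegralLattice : Set where
  field
    rank          : ℕ
    gram          : Mat rank rank
    symmetric     : ∀ i j → gram i j ≈ gram j i
    nondegenerate : ∀ (x : Fin rank → ℤ₂) →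
                    (∀ i → ∑ (λ j → gram i j *₂ x j) ≈ 0₂) → ∀ j → x j ≈ 0₂
open IntegralLattice public

-- Gram matrices A (n×n) and B (m×m) define isometric lattices:
-- there is an invertible change of basis P over ℤ₂ with Pᵀ A P = B.
Isometric : ∀ {n m} → Mat n n → Mat m m → Set
Isometric {n} {m} A B =
  Σ[ P ∈ Mat n m ] Σ[ Q ∈ Mat m n ]
    (P ⊗ Q ≈ₘ 𝟙) × (Q ⊗ P ≈ₘ 𝟙) × ((P ᵀ) ⊗ A ⊗ P ≈ₘ B)

------------------------------------------------------------------------
-- Terms and fine symbols
------------------------------------------------------------------------

data Label : Set where
  G R : Label

data Kind : Set where
  typeII : Kind
  typeI  : Label → Kind     -- typeI G = giver, typeI R = receiver

-- A term of scale 2^exp (exp : ℕ; see NOTES.md), sign and kind.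
record Term : Set where
  constructor term
  field
    exp  : ℕ
    sign : Sign
    kind : Kind
open Term public

dimK : Kind → ℕ
dimK typeII    = 2
dimK (typeI _) = 1

-- the scale q = 2^e as an integer
sc : ℕ → ℤ
sc e = + (2 ℕ.^ e)

private
  mat2 : ℤ → ℤ → ℤ → ℤ → Mat 2 2
  mat2 a b c d Fin.zero    Fin.zero    = ι a
  mat2 a b c d Fin.zero    (Fin.suc _) = ι b
  mat2 a b c d (Fin.suc _) Fin.zero    = ι c
  mat2 a b c d (Fin.suc _) (Fin.suc _) = ι d

  mat1 : ℤ → Mat 1 1
  mat1 a _ _ = ι a

termGram : (t : Term) → Mat (dimK (kind t)) (dimK (kind t))
termGram (term e Sign.+ typeII)    = mat2 ℤ.0ℤ (sc e) (sc e) ℤ.0ℤ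
termGram (term e Sign.- typeII)    = mat2 (+ 2 ℤ.* sc e) (sc e) (sc e) (+ 2 ℤ.* sc e)
termGram (term e Sign.+ (typeI G)) = mat1 (sc e)
termGram (term e Sign.- (typeI G)) = mat1 (ℤ.- (+ 3 ℤ.* sc e))
termGram (term e Sign.+ (typeI R)) = mat1 (ℤ.- sc e)
termGram (term e Sign.- (typeI R)) = mat1 (+ 3 ℤ.* sc e)

symDim : List Term → ℕ
symDim []      = 0
symDim (t ∷ F) = dimK (kind t) ℕ.+ symDim F

-- Gram matrix of the orthogonal sum of the terms of a symbol
symGram : (F : List Term) → Mat (symDim F) (symDim F)
symGram []      ()
symGram (t ∷ F) = termGram t ⊕ symGram F

IsTypeI IsTypeII : Term → Set
IsTypeI  t = Σ Label λ l → kind t ≡ typeI l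
IsTypeII t = kind t ≡ typeII

-- the condition on type II terms in a fine decomposition
WellFormed : List Term → Set
WellFormed F = ∀ (i j : Fin (length F)) →
  IsTypeII (List.lookup F i) → exp (List.lookup F j) ≡ exp (List.lookup F i) →
  IsTypeII (List.lookup F j)

FineSymbolFor : IntegralLattice → List Term → Set
FineSymbolFor L F = WellFormed F × Isometric (gram L) (symGram F)

------------------------------------------------------------------------
-- Operations
------------------------------------------------------------------------

-- modify each position of a symbol
modify : (F : List Term) → (Fin (length F) → Term → Term) → List Term
modify []      f = []
modify (t ∷ F) f = f Fin.zero t ∷ modify F (λ i → f (Fin.suc i))

negSign : Term → Term
negSign (term e s k) = term e (flipSign s) k

swapLabel : Kind → Kind
swapLabel typeII    = typeII
swapLabel (typeI G) = typeI R
swapLabel (typeI R) = typeI G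

-- scales differ by a factor 2^d
ExpDiff : ℕ → Term → Term → Set
ExpDiff d t u = (exp u ≡ d ℕ.+ exp t) ⊎ (exp t ≡ d ℕ.+ exp u)

-- the four admissible situations for sign walking
data SWCase (t u : Term) : Set where
  case0 : exp t ≡ exp u → SWCase t u
  case1 : ExpDiff 1 t u → (IsTypeI t × IsTypeII u) ⊎ (IsTypeII t × IsTypeI u) → SWCase t u
  case2 : ExpDiff 1 t u → (l : Label) → kind t ≡ typeI l → kind u ≡ typeI l → SWCase t u
  case3 : ExpDiff 2 t u → IsTypeI t → IsTypeI u → SWCase t u

walk : ∀ {t u} → SWCase t u → Term → Term
walk (case2 _ _ _ _) (term e s k) = term e (flipSign s) (swapLabel k)
walk _               x            = negSign x

SignWalk : List Term → List Term → Set
SignWalk F F′ = Σ[ i ∈ Fin (length F) ] Σ[ j ∈ Fin (length F) ]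
  (¬ i ≡ j) × Σ[ c ∈ SWCase (List.lookup F i) (List.lookup F j) ]
  F′ ≡ modify F (λ k t → if does (k Fin.≟ i) ∨ does (k Fin.≟ j) then walk c t else t)

-- a set of type I terms whose scales form {2^a, …, 2^b}
ScaleInterval : (F : List Term) → Subset (length F) → Set
ScaleInterval F C =
  (∀ k → k ∈ C → IsTypeI (List.lookup F k)) ×
  Σ[ a ∈ ℕ ] Σ[ b ∈ ℕ ] (a ≤ b) ×
    (∀ k → k ∈ C → a ≤ exp (List.lookup F k) × exp (List.lookup F k) ≤ b) ×
    (∀ e → a ≤ e → e ≤ b → Σ[ k ∈ Fin (length F) ] k ∈ C × exp (List.lookup F k) ≡ e)

-- a compartment: a maximal such set
Compartment : (F : List Term) → Subset (length F) → Set
Compartment F C = ScaleInterval F C × (∀ D → ScaleInterval F D → C ⊆ D → D ⊆ C)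

setKind : Kind → Term → Term
setKind k (term e s _) = term e s k

-- permute labels within a compartment C: π fixes every position outside C,
-- position k receives the label of position π k
GiverPerm : List Term → List Term → Set
GiverPerm F F′ = Σ[ C ∈ Subset (length F) ] Compartment F C ×
  Σ[ π ∈ Permutation′ (length F) ] (∀ k → ¬ (k ∈ C) → π ⟨$⟩ʳ k ≡ k) ×
  F′ ≡ modify F (λ k t → setKind (kind (List.lookup F (π ⟨$⟩ʳ k))) t)

flipLabel : Label → Label
flipLabel G = R
flipLabel R = G

-- change four terms of a compartment, all labelled l, to the other label
GiverConv : List Term → List Term → Set
GiverConv F F′ = Σ[ C ∈ Subset (length F) ] Compartment F C ×
  Σ[ S ∈ Subset (length F) ] S ⊆ C × ∣ S ∣ ≡ 4 × Σ[ l ∈ Label ]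
  (∀ k → k ∈ S → kind (List.lookup F k) ≡ typeI l) ×
  F′ ≡ modify F (λ k t → if lookup S k then setKind (typeI (flipLabel l)) t else t)

data Move (F F′ : List Term) : Set where
  signWalk  : SignWalk F F′  → Move F F′
  giverPerm : GiverPerm F F′ → Move F F′
  giverConv : GiverConv F F′ → Move F F′

-- finite sequences of operations
Moves : List Term → List Term → Set
Moves = Star Move

module Submission where

-- Lemma 5.4.  If some fine symbol of an integral ℤ₂-lattice L contains 1^{ε2}_II,
-- then sign walks (at most one) turn every fine symbol F of L into one containing it.
--
-- Idea.  For a Gram matrix M of rank n and χ : ℤ/4 → ℤ[i] consider the Gauss sums
--   Γ_χ(M) = Σ_{x ∈ (ℤ/4)ⁿ} χ(xᵀMx)   and   Β_χ(M) = Σ_{x,y ∈ (ℤ/4)ⁿ} χ(xᵀMy).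
-- They only depend on M modulo 4, a change of basis permutes (ℤ/4)ⁿ, so they are
-- isometry invariants, and for a character χ they are multiplicative over
-- orthogonal sums; on a fine symbol they are products of per-term values, which
-- are evaluations of finite sums.  Let F₀ be the symbol containing 1^{ε2}_II; all
-- its terms of scale 1 then have type II.  Comparing F with F₀:
--   * χ = 1 counts points: F and F₀ have the same number 4^rank of points;
--   * χ = (-1)ᵘ vanishes on a type I term of scale 1, so F has none;
--   * Β for (-1)ᵘ is divided by 4 by 1^{±2}_II, so F has a term of scale 1, some 1^{s2}_II;
--   * if s ≠ ε and F has another term of scale 1 or a type I term of scale 2, one
--     sign walk (case 0 or 1) flips s; otherwise χ = iᵘ gives Γ(F) = -ε·8·W, while
--     Γ(F₀) = ε·8·Z with Z = W or |Z| ≤ W/2, which is impossible.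
--
-- Structure: sums over (ℤ/4)ⁿ in a commutative semiring; congruences modulo 4;
-- integer matrices and the reduction of 2-adic Gram matrices; Gauss sums, their
-- invariance and multiplicativity; the Gaussian integers and three characters;
-- tables of Gauss sums of single terms; products over fine symbols; the three
-- comparisons between F₀ and F; sign walks; the theorem.

open import Defs
open import Data.Sign using (Sign)
open import Data.Product using (Σ-syntax; _×_)
open import Data.List using (List)
open import Data.List.Membership.Propositional using (_∈_)

open import Level using (0ℓ)
open import Algebra.Bundles using (Semiring; CommutativeSemiring)
open import Algebra.Structures using (IsSemigroup)
open import Algebra.Structures.Biased using (isCommutativeMonoidˡ; isCommutativeSemiringˡ)
open import Data.Bool using (Bool; true; false; if_then_else_; _∨_)
open import Data.Empty using (⊥; ⊥-elim)
open import Data.Fin as Fin using (Fin; zero; suc; toℕ; _↑ˡ_; _↑ʳ_)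
open import Data.Fin.Properties as Finₚ using (splitAt-↑ˡ; splitAt-↑ʳ)
open import Data.Integer as ℤ using (ℤ; +_; 0ℤ; 1ℤ; -1ℤ; _◃_)
open import Data.Integer.Divisibility.Signed using (_∣_; divides; _∣?_; ∣m∣n⇒∣m+n; ∣m⇒∣-m; ∣n⇒∣m*n; ∣m⇒∣m*n)
open import Data.Integer.DivMod using (_%ℕ_; _/ℕ_; n%ℕd<d; a≡a%ℕn+[a/ℕn]*n)
import Data.Integer.Properties as ℤₚ
import Data.Integer.Tactic.RingSolver as ℤ-Solver
open import Data.List using ([]; _∷_; length; lookup)
open import Data.List.Membership.Propositional.Properties using (∈-lookup)
open import Data.List.Relation.Unary.Any using (here; there; index)
open import Data.List.Relation.Unary.Any.Properties using (lookup-index)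
open import Data.Nat as ℕ using (ℕ; zero; suc; _≤_; z≤n)
import Data.Nat.Properties as ℕₚ
import Data.Nat.Tactic.RingSolver as ℕ-Solver
open import Data.Product using (_,_; proj₁)
open import Data.Sign using (opposite)
import Data.Sign.Properties as Signₚ
open import Data.Sum using (_⊎_; inj₁; inj₂)
open import Data.Vec as Vec using (Vec; []; _∷_; _++_; tabulate)
import Data.Vec.Properties as Vecₚ
open import Relation.Binary.Bundles using (Setoid)
open import Relation.Binary.Construct.Closure.ReflexiveTransitive using (_◅_) renaming (ε to done)
open import Relation.Binary.Definitions using (DecidableEquality)
open import Relation.Binary.PropositionalEquality
  using (_≡_; refl; sym; trans; cong; cong₂; subst; subst₂; module ≡-Reasoning)
open import Relation.Binary.PropositionalEquality.Algebra using () renaming (isMagma to ≡-isMagma)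
open import Relation.Nullary using (¬_; Dec; yes; no; does; map′)
open import Relation.Nullary.Decidable using (toWitness; dec-true; ¬?; _×-dec_; _→-dec_)
open import Algebra.Properties.Semiring.Sum ℤₚ.+-*-semiring
  using (sum; sum-syntax; sum-cong-≗; sum-replicate-zero; ∑-comm; *-distribˡ-sum; *-distribʳ-sum)


-- (ℤ/4)ⁿ, with ℤ/4 represented by Fin 4
Cube : ℕ → Set
Cube = Vec (Fin 4)

-- Summing against a Kronecker delta selects one term (in any semiring).
module _ {c ℓ} (S : Semiring c ℓ) where
  open Semiring S renaming (_≈_ to _≃_; refl to ≃-refl; trans to ≃-trans)
  open import Algebra.Properties.Semiring.Sum S using () renaming (sum to ∑ᴿ; sum-cong-≋ to ∑ᴿ-cong; sum-replicate-zero to ∑ᴿ-zero)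

  sum-select : ∀ {k} (a : Fin k) (f : Fin k → Carrier) →
               ∑ᴿ (λ b → if does (a Fin.≟ b) then f b else 0#) ≃ f a
  sum-select {suc k} Fin.zero    f = ≃-trans (+-congˡ (≃-trans (∑ᴿ-cong {k} (λ _ → ≃-refl)) (∑ᴿ-zero k))) (+-identityʳ _)
  sum-select {suc k} (Fin.suc a) f = ≃-trans (+-identityˡ _) (sum-select a (λ b → f (Fin.suc b)))

-- Finite sums over (ℤ/4)ⁿ with values in a commutative semiring.
module CubeSums {c ℓ} (R : CommutativeSemiring c ℓ) where
  open CommutativeSemiring R renaming (_≈_ to _≃_; refl to ≃-refl; sym to ≃-sym; trans to ≃-trans)
  open import Algebra.Properties.Semiring.Sum semiring using ()
    renaming (sum to ∑ᴿ; sum-cong-≋ to ∑ᴿ-cong; ∑-comm to ∑ᴿ-comm; *-distribˡ-sum to *-distribˡ-∑ᴿ; sum-replicate-zero to ∑ᴿ-zero)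
  open import Relation.Binary.Reasoning.Setoid setoid

  ∑ᶜ : ∀ n → (Cube n → Carrier) → Carrier
  ∑ᶜ zero    g = g []
  ∑ᶜ (suc n) g = ∑ᴿ (λ a → ∑ᶜ n (λ v → g (a ∷ v)))

  ∑ᶜ-cong : ∀ n {f g : Cube n → Carrier} → (∀ v → f v ≃ g v) → ∑ᶜ n f ≃ ∑ᶜ n g
  ∑ᶜ-cong zero    f≈g = f≈g []
  ∑ᶜ-cong (suc n) f≈g = ∑ᴿ-cong (λ a → ∑ᶜ-cong n (λ v → f≈g (a ∷ v)))

  ∑ᶜ-zero : ∀ n → ∑ᶜ n (λ _ → 0#) ≃ 0#
  ∑ᶜ-zero zero    = ≃-refl
  ∑ᶜ-zero (suc n) = ≃-trans (∑ᴿ-cong {4} (λ _ → ∑ᶜ-zero n)) (∑ᴿ-zero 4)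

  ∑ᶜ-*ˡ : ∀ n x (f : Cube n → Carrier) → ∑ᶜ n (λ v → x * f v) ≃ x * ∑ᶜ n f
  ∑ᶜ-*ˡ zero    x f = ≃-refl
  ∑ᶜ-*ˡ (suc n) x f = ≃-trans (∑ᴿ-cong (λ a → ∑ᶜ-*ˡ n x (λ v → f (a ∷ v))))
                            (≃-sym (*-distribˡ-∑ᴿ x (λ a → ∑ᶜ n (λ v → f (a ∷ v)))))

  ∑ᶜ-*ʳ : ∀ n x (f : Cube n → Carrier) → ∑ᶜ n (λ v → f v * x) ≃ ∑ᶜ n f * x
  ∑ᶜ-*ʳ n x f = ≃-trans (∑ᶜ-cong n (λ v → *-comm (f v) x)) (≃-trans (∑ᶜ-*ˡ n x f) (*-comm x _))

  -- a finite sum over Fin k commutes with a cube sum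
  sum-∑ᶜ : ∀ {k} n (h : Fin k → Cube n → Carrier) →
           ∑ᴿ (λ a → ∑ᶜ n (h a)) ≃ ∑ᶜ n (λ v → ∑ᴿ (λ a → h a v))
  sum-∑ᶜ zero    h = ≃-refl
  sum-∑ᶜ (suc n) h = ≃-trans (∑ᴿ-comm (λ a b → ∑ᶜ n (λ v → h a (b ∷ v))))
                           (∑ᴿ-cong (λ b → sum-∑ᶜ n (λ a v → h a (b ∷ v))))

  -- Fubini for cube sums
  ∑ᶜ-comm : ∀ m n (h : Cube m → Cube n → Carrier) →
            ∑ᶜ m (λ x → ∑ᶜ n (h x)) ≃ ∑ᶜ n (λ y → ∑ᶜ m (λ x → h x y))
  ∑ᶜ-comm zero    n h = ≃-refl
  ∑ᶜ-comm (suc m) n h = ≃-trans (∑ᴿ-cong (λ a → ∑ᶜ-comm m n (λ x → h (a ∷ x))))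
                              (sum-∑ᶜ n (λ a y → ∑ᶜ m (λ x → h (a ∷ x) y)))

  -- the sum of a product of functions of independent variables
  ∑ᶜ-product : ∀ m n (f : Cube m → Carrier) (g : Cube n → Carrier) →
               ∑ᶜ m (λ x → ∑ᶜ n (λ y → f x * g y)) ≃ ∑ᶜ m f * ∑ᶜ n g
  ∑ᶜ-product m n f g = ≃-trans (∑ᶜ-cong m (λ x → ∑ᶜ-*ˡ n (f x) g)) (∑ᶜ-*ʳ m (∑ᶜ n g) f)

  -- (ℤ/4)ᵐ⁺ⁿ = (ℤ/4)ᵐ × (ℤ/4)ⁿ
  ∑ᶜ-++ : ∀ m n (g : Cube (m ℕ.+ n) → Carrier) →
          ∑ᶜ (m ℕ.+ n) g ≃ ∑ᶜ m (λ x → ∑ᶜ n (λ y → g (x ++ y)))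
  ∑ᶜ-++ zero    n g = ≃-refl
  ∑ᶜ-++ (suc m) n g = ∑ᴿ-cong (λ a → ∑ᶜ-++ m n (λ v → g (a ∷ v)))

  -- the Kronecker delta on Fin k and on cubes, as a selector
  _≟ᶜ_ : ∀ {n} (x y : Cube n) → Bool
  x ≟ᶜ y = does (Vecₚ.≡-dec Fin._≟_ x y)

  ∑ᶜ-select : ∀ n (x : Cube n) (g : Cube n → Carrier) →
              ∑ᶜ n (λ y → if x ≟ᶜ y then g y else 0#) ≃ g x
  ∑ᶜ-select zero    []      g = ≃-refl
  ∑ᶜ-select (suc n) (a ∷ x) g = ≃-trans (∑ᴿ-cong inner) (sum-select semiring a (λ b → g (b ∷ x)))
    where
    inner : ∀ b → ∑ᶜ n (λ y → if (a ∷ x) ≟ᶜ (b ∷ y) then g (b ∷ y) else 0#)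
                ≃ (if does (a Fin.≟ b) then g (b ∷ x) else 0#)
    inner b with does (a Fin.≟ b)
    ... | true  = ∑ᶜ-select n x (λ y → g (b ∷ y))
    ... | false = ∑ᶜ-zero n

  -- cube sums are invariant under reindexing along a bijection
  ∑ᶜ-reindex : ∀ m n (σ : Cube m → Cube n) (τ : Cube n → Cube m) →
               (∀ x → τ (σ x) ≡ x) → (∀ y → σ (τ y) ≡ y) →
               (g : Cube n → Carrier) → ∑ᶜ m (λ x → g (σ x)) ≃ ∑ᶜ n g
  ∑ᶜ-reindex m n σ τ τσ στ g = begin
    ∑ᶜ m (λ x → g (σ x))                                       ≈⟨ ∑ᶜ-cong m (λ x → ∑ᶜ-select n (σ x) (λ _ → g (σ x))) ⟨
    ∑ᶜ m (λ x → ∑ᶜ n (λ y → if σ x ≟ᶜ y then g (σ x) else 0#)) ≈⟨ ∑ᶜ-cong m (λ x → ∑ᶜ-cong n (λ y → select-swap x y)) ⟩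
    ∑ᶜ m (λ x → ∑ᶜ n (λ y → if τ y ≟ᶜ x then g y else 0#))     ≈⟨ ∑ᶜ-comm m n _ ⟩
    ∑ᶜ n (λ y → ∑ᶜ m (λ x → if τ y ≟ᶜ x then g y else 0#))     ≈⟨ ∑ᶜ-cong n (λ y → ∑ᶜ-select m (τ y) (λ _ → g y)) ⟩
    ∑ᶜ n g                                                     ∎
    where
    select-swap : ∀ x y → (if σ x ≟ᶜ y then g (σ x) else 0#) ≃ (if τ y ≟ᶜ x then g y else 0#)
    select-swap x y with Vecₚ.≡-dec Fin._≟_ (σ x) y | Vecₚ.≡-dec Fin._≟_ (τ y) x
    ... | yes refl | yes _     = ≃-refl
    ... | yes refl | no τσx≢x  = ⊥-elim (τσx≢x (τσ x))
    ... | no σx≢y    | yes refl = ⊥-elim (σx≢y (στ y))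
    ... | no _       | no _      = ≃-refl

-- Congruence modulo 4 in ℤ (a record, so that a and b can be inferred from a proof).
infix 4 _≡₄_
record _≡₄_ (a b : ℤ) : Set where
  constructor by4∣
  field 4∣a-b : + 4 ∣ a ℤ.- b

≡₄-reflexive : ∀ {a b} → a ≡ b → a ≡₄ b
≡₄-reflexive {a} refl = by4∣ (divides 0ℤ (a-a a))
  where a-a : ∀ a → a ℤ.- a ≡ 0ℤ ℤ.* + 4
        a-a = ℤ-Solver.solve-∀

≡₄-refl : ∀ {a} → a ≡₄ a
≡₄-refl = ≡₄-reflexive refl

≡₄-sym : ∀ {a b} → a ≡₄ b → b ≡₄ a
≡₄-sym {a} {b} (by4∣ 4∣a-b) = by4∣ (subst (+ 4 ∣_) (negate a b) (∣m⇒∣-m 4∣a-b))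
  where negate : ∀ a b → ℤ.- (a ℤ.- b) ≡ b ℤ.- a
        negate = ℤ-Solver.solve-∀

≡₄-trans : ∀ {a b c} → a ≡₄ b → b ≡₄ c → a ≡₄ c
≡₄-trans {a} {b} {c} (by4∣ 4∣a-b) (by4∣ 4∣b-c) = by4∣ (subst (+ 4 ∣_) (telescope a b c) (∣m∣n⇒∣m+n 4∣a-b 4∣b-c))
  where telescope : ∀ a b c → (a ℤ.- b) ℤ.+ (b ℤ.- c) ≡ a ℤ.- c
        telescope = ℤ-Solver.solve-∀

≡₄-+ : ∀ {a b c d} → a ≡₄ b → c ≡₄ d → a ℤ.+ c ≡₄ b ℤ.+ d
≡₄-+ {a} {b} {c} {d} (by4∣ 4∣a-b) (by4∣ 4∣c-d) = by4∣ (subst (+ 4 ∣_) (regroup a b c d) (∣m∣n⇒∣m+n 4∣a-b 4∣c-d))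
  where regroup : ∀ a b c d → (a ℤ.- b) ℤ.+ (c ℤ.- d) ≡ (a ℤ.+ c) ℤ.- (b ℤ.+ d)
        regroup = ℤ-Solver.solve-∀

≡₄-* : ∀ {a b c d} → a ≡₄ b → c ≡₄ d → a ℤ.* c ≡₄ b ℤ.* d
≡₄-* {a} {b} {c} {d} (by4∣ 4∣a-b) (by4∣ 4∣c-d) =
  by4∣ (subst (+ 4 ∣_) (regroup a b c d) (∣m∣n⇒∣m+n (∣n⇒∣m*n a 4∣c-d) (∣m⇒∣m*n d 4∣a-b)))
  where regroup : ∀ a b c d → a ℤ.* (c ℤ.- d) ℤ.+ (a ℤ.- b) ℤ.* d ≡ a ℤ.* c ℤ.- b ℤ.* d
        regroup = ℤ-Solver.solve-∀

-- Residues modulo 4, represented by Fin 4.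
toℤ : Fin 4 → ℤ
toℤ u = + toℕ u

red : ℤ → Fin 4
red a = Fin.fromℕ< (n%ℕd<d a 4)

red-correct : ∀ a → toℤ (red a) ≡₄ a
red-correct a = by4∣ (divides (ℤ.- (a /ℕ 4)) (begin
  toℤ (red a) ℤ.- a                               ≡⟨ cong (λ r → + r ℤ.- a) (Finₚ.toℕ-fromℕ< (n%ℕd<d a 4)) ⟩
  + (a %ℕ 4) ℤ.- a                                ≡⟨ cong (λ a′ → + (a %ℕ 4) ℤ.- a′) (a≡a%ℕn+[a/ℕn]*n a 4) ⟩
  + (a %ℕ 4) ℤ.- (+ (a %ℕ 4) ℤ.+ (a /ℕ 4) ℤ.* + 4) ≡⟨ cancel (+ (a %ℕ 4)) (a /ℕ 4) ⟩
  ℤ.- (a /ℕ 4) ℤ.* + 4                            ∎))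
  where open ≡-Reasoning
        cancel : ∀ r q → r ℤ.- (r ℤ.+ q ℤ.* + 4) ≡ ℤ.- q ℤ.* + 4
        cancel = ℤ-Solver.solve-∀

-- distinct residues are incongruent (a finite check)
toℤ-injective₄ : ∀ u w → toℤ u ≡₄ toℤ w → u ≡ w
toℤ-injective₄ u w u≡₄w with u Fin.≟ w
... | yes u≡w = u≡w
... | no  u≢w = ⊥-elim (incongruent u w u≢w u≡₄w)
  where
  differences : ∀ u w → ¬ u ≡ w → ¬ + 4 ∣ toℤ u ℤ.- toℤ w
  differences = toWitness {a? = Finₚ.all? λ u → Finₚ.all? λ w →
                                 ¬? (u Fin.≟ w) →-dec ¬? (+ 4 ∣? (toℤ u ℤ.- toℤ w))} _
  incongruent : ∀ u w → ¬ u ≡ w → ¬ toℤ u ≡₄ toℤ w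
  incongruent u w u≢w (by4∣ 4∣u-w) = differences u w u≢w 4∣u-w

red-cong : ∀ {a b} → a ≡₄ b → red a ≡ red b
red-cong {a} {b} a≡₄b = toℤ-injective₄ (red a) (red b)
  (≡₄-trans (red-correct a) (≡₄-trans a≡₄b (≡₄-sym (red-correct b))))

red-toℤ : ∀ u → red (toℤ u) ≡ u
red-toℤ u = toℤ-injective₄ (red (toℤ u)) u (red-correct (toℤ u))

-- Congruence modulo 4 as a setoid, for chains of congruences.
≡₄-setoid : Setoid 0ℓ 0ℓ
≡₄-setoid = record
  { Carrier = ℤ ; _≈_ = _≡₄_
  ; isEquivalence = record { refl = ≡₄-refl ; sym = ≡₄-sym ; trans = ≡₄-trans } }

sum-≡₄ : ∀ {n} {f g : Fin n → ℤ} → (∀ i → f i ≡₄ g i) → sum f ≡₄ sum g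
sum-≡₄ {zero}  f≡₄g = ≡₄-refl
sum-≡₄ {suc n} f≡₄g = ≡₄-+ (f≡₄g zero) (sum-≡₄ (λ i → f≡₄g (suc i)))

-- A sum over Fin (m + n) splits into the sums over the two blocks.
sum-++ : ∀ m n (f : Fin (m ℕ.+ n) → ℤ) →
         sum f ≡ sum (λ i → f (i ↑ˡ n)) ℤ.+ sum (λ j → f (m ↑ʳ j))
sum-++ zero    n f = sym (ℤₚ.+-identityˡ (sum f))
sum-++ (suc m) n f = trans (cong (λ s → f zero ℤ.+ s) (sum-++ m n (λ i → f (suc i))))
                           (sym (ℤₚ.+-assoc (f zero) _ _))

sum-zero : ∀ {n} (f : Fin n → ℤ) → (∀ i → f i ≡ 0ℤ) → sum f ≡ 0ℤ
sum-zero {n} f f≡0 = trans (sum-cong-≗ f≡0) (sum-replicate-zero n)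

-- Integer matrices; Gram matrices reduced modulo 4 live here.
Matℤ : ℕ → ℕ → Set
Matℤ m n = Fin m → Fin n → ℤ

infixr 7 _▷_
infixl 7 _⊠_
infix  6 _∙_

-- a matrix acting on a column vector
_▷_ : ∀ {m n} → Matℤ m n → (Fin n → ℤ) → Fin m → ℤ
(M ▷ x) i = ∑[ j < _ ] (M i j ℤ.* x j)

_⊠_ : ∀ {l m n} → Matℤ l m → Matℤ m n → Matℤ l n
(M ⊠ N) i k = ∑[ j < _ ] (M i j ℤ.* N j k)

_ᵗ : ∀ {m n} → Matℤ m n → Matℤ n m
(M ᵗ) i j = M j i

_∙_ : ∀ {n} → (Fin n → ℤ) → (Fin n → ℤ) → ℤ
x ∙ y = ∑[ i < _ ] (x i ℤ.* y i)

-- the bilinear form with Gram matrix M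
form : ∀ {n} → Matℤ n n → (Fin n → ℤ) → (Fin n → ℤ) → ℤ
form M x y = x ∙ M ▷ y

-- the matrix action, the dot product and the form respect congruence modulo 4
▷-cong₄ : ∀ {m n} {M N : Matℤ m n} {x y : Fin n → ℤ} →
          (∀ i j → M i j ≡₄ N i j) → (∀ j → x j ≡₄ y j) → ∀ i → (M ▷ x) i ≡₄ (N ▷ y) i
▷-cong₄ M≡₄N x≡₄y i = sum-≡₄ (λ j → ≡₄-* (M≡₄N i j) (x≡₄y j))

∙-cong₄ : ∀ {n} {x x′ y y′ : Fin n → ℤ} → (∀ i → x i ≡₄ x′ i) → (∀ i → y i ≡₄ y′ i) → x ∙ y ≡₄ x′ ∙ y′
∙-cong₄ x≡₄x′ y≡₄y′ = sum-≡₄ (λ i → ≡₄-* (x≡₄x′ i) (y≡₄y′ i))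

form-congᴹ : ∀ {n} {M N : Matℤ n n} → (∀ i j → M i j ≡₄ N i j) → ∀ x y → form M x y ≡₄ form N x y
form-congᴹ M≡₄N x y = ∙-cong₄ {x = x} {x} (λ _ → ≡₄-refl) (▷-cong₄ M≡₄N (λ j → ≡₄-refl {y j}))

form-congᵛ : ∀ {n} (M : Matℤ n n) {x x′ y y′ : Fin n → ℤ} →
             (∀ i → x i ≡₄ x′ i) → (∀ i → y i ≡₄ y′ i) → form M x y ≡₄ form M x′ y′
form-congᵛ M x≡₄x′ y≡₄y′ = ∙-cong₄ x≡₄x′ (▷-cong₄ (λ i j → ≡₄-refl {M i j}) y≡₄y′)

-- the action of a product is the composite of the actions
▷-⊠ : ∀ {l m n} (M : Matℤ l m) (N : Matℤ m n) x i → (M ▷ N ▷ x) i ≡ ((M ⊠ N) ▷ x) i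
▷-⊠ {l} {m} {n} M N x i = begin
  ∑[ j < m ] (M i j ℤ.* ∑[ k < n ] (N j k ℤ.* x k))     ≡⟨ sum-cong-≗ (λ j → *-distribˡ-sum (M i j) (λ k → N j k ℤ.* x k)) ⟩
  ∑[ j < m ] ∑[ k < n ] (M i j ℤ.* (N j k ℤ.* x k))     ≡⟨ ∑-comm (λ j k → M i j ℤ.* (N j k ℤ.* x k)) ⟩
  ∑[ k < n ] ∑[ j < m ] (M i j ℤ.* (N j k ℤ.* x k))     ≡⟨ sum-cong-≗ (λ k → sum-cong-≗ (λ j → sym (ℤₚ.*-assoc (M i j) (N j k) (x k)))) ⟩
  ∑[ k < n ] ∑[ j < m ] (M i j ℤ.* N j k ℤ.* x k)       ≡⟨ sum-cong-≗ (λ k → *-distribʳ-sum (x k) (λ j → M i j ℤ.* N j k)) ⟨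
  ∑[ k < n ] (∑[ j < m ] (M i j ℤ.* N j k) ℤ.* x k)     ∎
  where open ≡-Reasoning

-- the transpose is the adjoint for the dot product
∙-▷ : ∀ {m n} (x : Fin m → ℤ) (M : Matℤ m n) y → x ∙ M ▷ y ≡ (M ᵗ ▷ x) ∙ y
∙-▷ {m} {n} x M y = begin
  ∑[ i < m ] (x i ℤ.* ∑[ j < n ] (M i j ℤ.* y j))     ≡⟨ sum-cong-≗ (λ i → *-distribˡ-sum (x i) (λ j → M i j ℤ.* y j)) ⟩
  ∑[ i < m ] ∑[ j < n ] (x i ℤ.* (M i j ℤ.* y j))     ≡⟨ ∑-comm (λ i j → x i ℤ.* (M i j ℤ.* y j)) ⟩
  ∑[ j < n ] ∑[ i < m ] (x i ℤ.* (M i j ℤ.* y j))     ≡⟨ sum-cong-≗ (λ j → sum-cong-≗ (λ i → regroup (x i) (M i j) (y j))) ⟩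
  ∑[ j < n ] ∑[ i < m ] (M i j ℤ.* x i ℤ.* y j)       ≡⟨ sum-cong-≗ (λ j → *-distribʳ-sum (y j) (λ i → M i j ℤ.* x i)) ⟨
  ∑[ j < n ] (∑[ i < m ] (M i j ℤ.* x i) ℤ.* y j)     ∎
  where open ≡-Reasoning
        regroup : ∀ a b c → a ℤ.* (b ℤ.* c) ≡ b ℤ.* a ℤ.* c
        regroup = ℤ-Solver.solve-∀

-- Change of basis: the form of Pᵗ A P is the form of A on the image vectors.
form-⊠ : ∀ {m n} (A : Matℤ n n) (P : Matℤ n m) y z →
         form ((P ᵗ ⊠ A) ⊠ P) y z ≡ form A (P ▷ y) (P ▷ z)
form-⊠ A P y z = begin
  y ∙ ((P ᵗ ⊠ A) ⊠ P) ▷ z     ≡⟨ sum-cong-≗ (λ i → cong (y i ℤ.*_) (sym (▷-⊠ (P ᵗ ⊠ A) P z i))) ⟩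
  y ∙ (P ᵗ ⊠ A) ▷ P ▷ z       ≡⟨ sum-cong-≗ (λ i → cong (y i ℤ.*_) (sym (▷-⊠ (P ᵗ) A (P ▷ z) i))) ⟩
  y ∙ P ᵗ ▷ A ▷ P ▷ z         ≡⟨ ∙-▷ y (P ᵗ) (A ▷ P ▷ z) ⟩
  (P ▷ y) ∙ A ▷ P ▷ z         ∎
  where open ≡-Reasoning

-- Summing against the identity matrix.
𝟙-▷ : ∀ {n} (x : Fin n → ℤ) i → ∑[ j < n ] ((if does (i Fin.≟ j) then 1ℤ else 0ℤ) ℤ.* x j) ≡ x i
𝟙-▷ {n} x i = trans (sum-cong-≗ (λ j → select (does (i Fin.≟ j)) (x j))) (sum-select ℤₚ.+-*-semiring i x)
  where select : ∀ b a → (if b then 1ℤ else 0ℤ) ℤ.* a ≡ (if b then a else 0ℤ)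
        select true  a = ℤₚ.*-identityˡ a
        select false a = ℤₚ.*-zeroˡ a

-- The residues modulo 4 of a matrix over ℤ₂ (approx at level 2).
⌊_⌋ : ∀ {m n} → Mat m n → Matℤ m n
⌊ A ⌋ i j = approx (A i j) 2

≈⇒≡₄ : ∀ {x y} → x ≈ y → approx x 2 ≡₄ approx y 2
≈⇒≡₄ x≈y with x≈y 2
... | q , x-y≡q*4 = by4∣ (divides q x-y≡q*4)

approx-∑ : ∀ {n} (f : Fin n → ℤ₂) k → approx (∑ f) k ≡ sum (λ i → approx (f i) k)
approx-∑ {zero}  f k = refl
approx-∑ {suc n} f k = cong (λ s → approx (f zero) k ℤ.+ s) (approx-∑ (λ i → f (suc i)) k)

-- reduction commutes with products
⌊⊗⌋ : ∀ {l m n} (M : Mat l m) (N : Mat m n) i k → ⌊ M ⊗ N ⌋ i k ≡ (⌊ M ⌋ ⊠ ⌊ N ⌋) i k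
⌊⊗⌋ M N i k = approx-∑ (λ j → M i j *₂ N j k) 2

⌊𝟙⌋ : ∀ {n} (i j : Fin n) → ⌊ 𝟙 ⌋ i j ≡ (if does (i Fin.≟ j) then 1ℤ else 0ℤ)
⌊𝟙⌋ i j with does (i Fin.≟ j)
... | true  = refl
... | false = refl

module _ {n m} (A : Mat n n) (B : Mat m m) (P : Mat n m) where
  open import Relation.Binary.Reasoning.Setoid ≡₄-setoid

  -- If Pᵀ A P = B then modulo 4 the form of B is the form of A on the P-images.
  form-isometry : (P ᵀ) ⊗ A ⊗ P ≈ₘ B → ∀ y z → form ⌊ B ⌋ y z ≡₄ form ⌊ A ⌋ (⌊ P ⌋ ▷ y) (⌊ P ⌋ ▷ z)
  form-isometry PᵀAP≈B y z = begin
    form ⌊ B ⌋ y z                           ≈⟨ form-congᴹ (λ i j → ≈⇒≡₄ {((P ᵀ) ⊗ A ⊗ P) i j} {B i j} (PᵀAP≈B i j)) y z ⟨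
    form ⌊ (P ᵀ) ⊗ A ⊗ P ⌋ y z               ≈⟨ form-congᴹ (λ i j → ≡₄-reflexive (⌊PᵀAP⌋ i j)) y z ⟩
    form ((⌊ P ⌋ ᵗ ⊠ ⌊ A ⌋) ⊠ ⌊ P ⌋) y z     ≡⟨ form-⊠ ⌊ A ⌋ ⌊ P ⌋ y z ⟩
    form ⌊ A ⌋ (⌊ P ⌋ ▷ y) (⌊ P ⌋ ▷ z)       ∎
    where
    ⌊PᵀAP⌋ : ∀ i k → ⌊ (P ᵀ) ⊗ A ⊗ P ⌋ i k ≡ ((⌊ P ⌋ ᵗ ⊠ ⌊ A ⌋) ⊠ ⌊ P ⌋) i k
    ⌊PᵀAP⌋ i k = trans (⌊⊗⌋ ((P ᵀ) ⊗ A) P i k)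
                       (sum-cong-≗ (λ j → cong (ℤ._* ⌊ P ⌋ j k) (⌊⊗⌋ (P ᵀ) A i j)))

-- If P Q = 𝟙 then ⌊ P ⌋ ⌊ Q ⌋ acts as the identity modulo 4.
▷-inverse : ∀ {n m} (P : Mat n m) (Q : Mat m n) → P ⊗ Q ≈ₘ 𝟙 → ∀ x i → (⌊ P ⌋ ▷ ⌊ Q ⌋ ▷ x) i ≡₄ x i
▷-inverse P Q PQ≈𝟙 x i = begin
  (⌊ P ⌋ ▷ ⌊ Q ⌋ ▷ x) i     ≡⟨ ▷-⊠ ⌊ P ⌋ ⌊ Q ⌋ x i ⟩
  ((⌊ P ⌋ ⊠ ⌊ Q ⌋) ▷ x) i   ≈⟨ ▷-cong₄ (λ i j → ≡₄-trans (≡₄-reflexive (sym (⌊⊗⌋ P Q i j)))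
                                                    (≡₄-trans (≈⇒≡₄ {(P ⊗ Q) i j} {𝟙 i j} (PQ≈𝟙 i j)) (≡₄-reflexive (⌊𝟙⌋ i j))))
                                       (λ _ → ≡₄-refl) i ⟩
  (δ ▷ x) i                 ≡⟨ 𝟙-▷ x i ⟩
  x i                       ∎
  where open import Relation.Binary.Reasoning.Setoid ≡₄-setoid
        δ : Matℤ _ _
        δ i j = if does (i Fin.≟ j) then 1ℤ else 0ℤ

-- The blocks of an orthogonal sum.
module _ {m n} (A : Mat m m) (B : Mat n n) where
  ⌊⊕⌋ˡˡ : ∀ i j → ⌊ A ⊕ B ⌋ (i ↑ˡ n) (j ↑ˡ n) ≡ ⌊ A ⌋ i j
  ⌊⊕⌋ˡˡ i j rewrite splitAt-↑ˡ m i n | splitAt-↑ˡ m j n = refl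
  ⌊⊕⌋ˡʳ : ∀ i j → ⌊ A ⊕ B ⌋ (i ↑ˡ n) (m ↑ʳ j) ≡ 0ℤ
  ⌊⊕⌋ˡʳ i j rewrite splitAt-↑ˡ m i n | splitAt-↑ʳ m n j = refl
  ⌊⊕⌋ʳˡ : ∀ i j → ⌊ A ⊕ B ⌋ (m ↑ʳ i) (j ↑ˡ n) ≡ 0ℤ
  ⌊⊕⌋ʳˡ i j rewrite splitAt-↑ʳ m n i | splitAt-↑ˡ m j n = refl
  ⌊⊕⌋ʳʳ : ∀ i j → ⌊ A ⊕ B ⌋ (m ↑ʳ i) (m ↑ʳ j) ≡ ⌊ B ⌋ i j
  ⌊⊕⌋ʳʳ i j rewrite splitAt-↑ʳ m n i | splitAt-↑ʳ m n j = refl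

  -- an orthogonal sum acts blockwise
  ▷-⊕ˡ : ∀ y i → (⌊ A ⊕ B ⌋ ▷ y) (i ↑ˡ n) ≡ (⌊ A ⌋ ▷ (λ j → y (j ↑ˡ n))) i
  ▷-⊕ˡ y i = trans (sum-++ m n _) (trans
    (cong₂ ℤ._+_ (sum-cong-≗ (λ j → cong (ℤ._* y (j ↑ˡ n)) (⌊⊕⌋ˡˡ i j)))
                 (sum-zero _ (λ j → trans (cong (ℤ._* y (m ↑ʳ j)) (⌊⊕⌋ˡʳ i j)) (ℤₚ.*-zeroˡ (y (m ↑ʳ j))))))
    (ℤₚ.+-identityʳ _))

  ▷-⊕ʳ : ∀ y i → (⌊ A ⊕ B ⌋ ▷ y) (m ↑ʳ i) ≡ (⌊ B ⌋ ▷ (λ j → y (m ↑ʳ j))) i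
  ▷-⊕ʳ y i = trans (sum-++ m n _) (trans
    (cong₂ ℤ._+_ (sum-zero _ (λ j → trans (cong (ℤ._* y (j ↑ˡ n)) (⌊⊕⌋ʳˡ i j)) (ℤₚ.*-zeroˡ (y (j ↑ˡ n)))))
                 (sum-cong-≗ (λ j → cong (ℤ._* y (m ↑ʳ j)) (⌊⊕⌋ʳʳ i j))))
    (ℤₚ.+-identityˡ _))

  -- the form of an orthogonal sum is the sum of the forms of the blocks
  form-⊕ : ∀ x y → form ⌊ A ⊕ B ⌋ x y ≡
           form ⌊ A ⌋ (λ i → x (i ↑ˡ n)) (λ i → y (i ↑ˡ n)) ℤ.+ form ⌊ B ⌋ (λ i → x (m ↑ʳ i)) (λ i → y (m ↑ʳ i))
  form-⊕ x y = trans (sum-++ m n _)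
    (cong₂ ℤ._+_ (sum-cong-≗ (λ i → cong (x (i ↑ˡ n) ℤ.*_) (▷-⊕ˡ y i)))
                 (sum-cong-≗ (λ i → cong (x (m ↑ʳ i) ℤ.*_) (▷-⊕ʳ y i))))

-- a point of (ℤ/4)ⁿ as an integer vector
⟦_⟧ : ∀ {n} → Cube n → Fin n → ℤ
⟦ x ⟧ i = toℤ (Vec.lookup x i)

-- the residue of an integer vector
reduce : ∀ {n} → (Fin n → ℤ) → Cube n
reduce v = tabulate (λ i → red (v i))

⟦reduce⟧ : ∀ {n} (v : Fin n → ℤ) i → ⟦ reduce v ⟧ i ≡₄ v i
⟦reduce⟧ v i = subst (λ u → toℤ u ≡₄ v i) (sym (Vecₚ.lookup∘tabulate (λ i → red (v i)) i)) (red-correct (v i))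

reduce-cong : ∀ {n} {v w : Fin n → ℤ} → (∀ i → v i ≡₄ w i) → reduce v ≡ reduce w
reduce-cong v≡₄w = Vecₚ.tabulate-cong (λ i → red-cong (v≡₄w i))

reduce-⟦⟧ : ∀ {n} (x : Cube n) → reduce ⟦ x ⟧ ≡ x
reduce-⟦⟧ x = trans (Vecₚ.tabulate-cong (λ i → red-toℤ (Vec.lookup x i))) (Vecₚ.tabulate∘lookup x)

-- An isometry of lattices induces a bijection between the (ℤ/4)-points
-- which preserves the forms modulo 4.
record ResidueIsometry {n m} (A : Matℤ n n) (B : Matℤ m m) : Set where
  field
    σ         : Cube m → Cube n
    τ         : Cube n → Cube m
    τ∘σ       : ∀ y → τ (σ y) ≡ y
    σ∘τ       : ∀ x → σ (τ x) ≡ x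
    preserves : ∀ y z → form B ⟦ y ⟧ ⟦ z ⟧ ≡₄ form A ⟦ σ y ⟧ ⟦ σ z ⟧

residueIsometry : ∀ {n m} (A : Mat n n) (B : Mat m m) → Isometric A B → ResidueIsometry ⌊ A ⌋ ⌊ B ⌋
residueIsometry A B (P , Q , PQ≈𝟙 , QP≈𝟙 , PᵀAP≈B) = record
  { σ         = act P
  ; τ         = act Q
  ; τ∘σ       = inverse Q P QP≈𝟙
  ; σ∘τ       = inverse P Q PQ≈𝟙
  ; preserves = λ y z → ≡₄-trans (form-isometry A B P PᵀAP≈B ⟦ y ⟧ ⟦ z ⟧)
      (form-congᵛ ⌊ A ⌋
                  (λ i → ≡₄-sym (⟦reduce⟧ (⌊ P ⌋ ▷ ⟦ y ⟧) i)) (λ i → ≡₄-sym (⟦reduce⟧ (⌊ P ⌋ ▷ ⟦ z ⟧) i)))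
  }
  where
  act : ∀ {k l} → Mat k l → Cube l → Cube k
  act P y = reduce (⌊ P ⌋ ▷ ⟦ y ⟧)
  inverse : ∀ {k l} (P : Mat k l) (Q : Mat l k) → P ⊗ Q ≈ₘ 𝟙 → ∀ x → act P (act Q x) ≡ x
  inverse P Q PQ≈𝟙 x = trans
    (reduce-cong (λ i → ≡₄-trans (▷-cong₄ (λ i j → ≡₄-refl {⌊ P ⌋ i j}) (⟦reduce⟧ (⌊ Q ⌋ ▷ ⟦ x ⟧)) i) (▷-inverse P Q PQ≈𝟙 ⟦ x ⟧ i)))
    (reduce-⟦⟧ x)

-- the form only depends on the values of the vectors
form-cong : ∀ {n} (M : Matℤ n n) {x x′ y y′ : Fin n → ℤ} → (∀ i → x i ≡ x′ i) → (∀ i → y i ≡ y′ i) →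
            form M x y ≡ form M x′ y′
form-cong M x≗x′ y≗y′ = sum-cong-≗ (λ i → cong₂ ℤ._*_ (x≗x′ i) (sum-cong-≗ (λ j → cong (M i j ℤ.*_) (y≗y′ j))))

-- the form of an orthogonal sum on concatenated points
form-++ : ∀ {m n} (A : Mat m m) (B : Mat n n) (x₁ y₁ : Cube m) (x₂ y₂ : Cube n) →
          form ⌊ A ⊕ B ⌋ ⟦ x₁ ++ x₂ ⟧ ⟦ y₁ ++ y₂ ⟧ ≡ form ⌊ A ⌋ ⟦ x₁ ⟧ ⟦ y₁ ⟧ ℤ.+ form ⌊ B ⌋ ⟦ x₂ ⟧ ⟦ y₂ ⟧
form-++ A B x₁ y₁ x₂ y₂ = trans (form-⊕ A B ⟦ x₁ ++ x₂ ⟧ ⟦ y₁ ++ y₂ ⟧)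
  (cong₂ ℤ._+_ (form-cong ⌊ A ⌋ (λ i → cong toℤ (Vecₚ.lookup-++ˡ x₁ x₂ i)) (λ i → cong toℤ (Vecₚ.lookup-++ˡ y₁ y₂ i)))
               (form-cong ⌊ B ⌋ (λ i → cong toℤ (Vecₚ.lookup-++ʳ x₁ x₂ i)) (λ i → cong toℤ (Vecₚ.lookup-++ʳ y₁ y₂ i))))

-- Gauss sums of a function χ on ℤ/4 over the quadratic form x ↦ xᵀMx and the
-- bilinear form (x, y) ↦ xᵀMy, with values in a commutative semiring.
module GaussSums {c ℓ} (R : CommutativeSemiring c ℓ) where
  open CommutativeSemiring R renaming (_≈_ to _≃_; sym to ≃-sym; trans to ≃-trans; reflexive to ≃-reflexive)
  open CubeSums R
  open import Relation.Binary.Reasoning.Setoid setoid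

  Γ : (Fin 4 → Carrier) → ∀ {n} → Matℤ n n → Carrier
  Γ χ {n} M = ∑ᶜ n (λ x → χ (red (form M ⟦ x ⟧ ⟦ x ⟧)))

  Β : (Fin 4 → Carrier) → ∀ {n} → Matℤ n n → Carrier
  Β χ {n} M = ∑ᶜ n (λ x → ∑ᶜ n (λ y → χ (red (form M ⟦ x ⟧ ⟦ y ⟧))))

  -- Gauss sums only depend on the Gram matrix modulo 4 ...
  Γ-cong₄ : ∀ χ {n} {M N : Matℤ n n} → (∀ i j → M i j ≡₄ N i j) → Γ χ M ≃ Γ χ N
  Γ-cong₄ χ {n} M≡₄N = ∑ᶜ-cong n (λ x → ≃-reflexive (cong χ (red-cong
    (form-congᴹ M≡₄N ⟦ x ⟧ ⟦ x ⟧))))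

  Β-cong₄ : ∀ χ {n} {M N : Matℤ n n} → (∀ i j → M i j ≡₄ N i j) → Β χ M ≃ Β χ N
  Β-cong₄ χ {n} M≡₄N = ∑ᶜ-cong n (λ x → ∑ᶜ-cong n (λ y → ≃-reflexive (cong χ (red-cong
    (form-congᴹ M≡₄N ⟦ x ⟧ ⟦ y ⟧)))))

  -- ... and are invariant under isometries.
  Γ-isometry : ∀ χ {n m} {M : Matℤ n n} {N : Matℤ m m} → ResidueIsometry M N → Γ χ M ≃ Γ χ N
  Γ-isometry χ {n} {m} {M} {N} ι = ≃-sym (begin
    ∑ᶜ m (λ y → χ (red (form N ⟦ y ⟧ ⟦ y ⟧)))         ≈⟨ ∑ᶜ-cong m (λ y → ≃-reflexive (cong χ (red-cong (preserves y y)))) ⟩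
    ∑ᶜ m (λ y → χ (red (form M ⟦ σ y ⟧ ⟦ σ y ⟧)))     ≈⟨ ∑ᶜ-reindex m n σ τ τ∘σ σ∘τ (λ x → χ (red (form M ⟦ x ⟧ ⟦ x ⟧))) ⟩
    ∑ᶜ n (λ x → χ (red (form M ⟦ x ⟧ ⟦ x ⟧)))         ∎)
    where open ResidueIsometry ι

  Β-isometry : ∀ χ {n m} {M : Matℤ n n} {N : Matℤ m m} → ResidueIsometry M N → Β χ M ≃ Β χ N
  Β-isometry χ {n} {m} {M} {N} ι = ≃-sym (begin
    ∑ᶜ m (λ y → ∑ᶜ m (λ z → χ (red (form N ⟦ y ⟧ ⟦ z ⟧))))
      ≈⟨ ∑ᶜ-cong m (λ y → ∑ᶜ-cong m (λ z → ≃-reflexive (cong χ (red-cong (preserves y z))))) ⟩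
    ∑ᶜ m (λ y → ∑ᶜ m (λ z → χ (red (form M ⟦ σ y ⟧ ⟦ σ z ⟧))))
      ≈⟨ ∑ᶜ-cong m (λ y → ∑ᶜ-reindex m n σ τ τ∘σ σ∘τ (λ x → χ (red (form M ⟦ σ y ⟧ ⟦ x ⟧)))) ⟩
    ∑ᶜ m (λ y → ∑ᶜ n (λ x → χ (red (form M ⟦ σ y ⟧ ⟦ x ⟧))))
      ≈⟨ ∑ᶜ-reindex m n σ τ τ∘σ σ∘τ (λ w → ∑ᶜ n (λ x → χ (red (form M ⟦ w ⟧ ⟦ x ⟧)))) ⟩
    ∑ᶜ n (λ w → ∑ᶜ n (λ x → χ (red (form M ⟦ w ⟧ ⟦ x ⟧)))) ∎)
    where open ResidueIsometry ι

  -- χ is a character of the additive group ℤ/4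
  IsCharacter : (Fin 4 → Carrier) → Set ℓ
  IsCharacter χ = ∀ u w → χ (red (toℤ u ℤ.+ toℤ w)) ≃ χ u * χ w

  character-ℤ : ∀ {χ} → IsCharacter χ → ∀ a b → χ (red (a ℤ.+ b)) ≃ χ (red a) * χ (red b)
  character-ℤ {χ} hom a b = ≃-trans
    (≃-reflexive (cong χ (red-cong (≡₄-+ (≡₄-sym (red-correct a)) (≡₄-sym (red-correct b))))))
    (hom (red a) (red b))

  -- For a character, Gauss sums are multiplicative under orthogonal sums.
  Γ-⊕ : ∀ {χ} → IsCharacter χ → ∀ {m n} (A : Mat m m) (B : Mat n n) →
        Γ χ ⌊ A ⊕ B ⌋ ≃ Γ χ ⌊ A ⌋ * Γ χ ⌊ B ⌋
  Γ-⊕ {χ} hom {m} {n} A B = begin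
    ∑ᶜ (m ℕ.+ n) (λ x → χ (red (form ⌊ A ⊕ B ⌋ ⟦ x ⟧ ⟦ x ⟧)))
      ≈⟨ ∑ᶜ-++ m n _ ⟩
    ∑ᶜ m (λ x₁ → ∑ᶜ n (λ x₂ → χ (red (form ⌊ A ⊕ B ⌋ ⟦ x₁ ++ x₂ ⟧ ⟦ x₁ ++ x₂ ⟧))))
      ≈⟨ ∑ᶜ-cong m (λ x₁ → ∑ᶜ-cong n (λ x₂ → ≃-trans
           (≃-reflexive (cong (λ q → χ (red q)) (form-++ A B x₁ x₁ x₂ x₂)))
           (character-ℤ hom (form ⌊ A ⌋ ⟦ x₁ ⟧ ⟦ x₁ ⟧) (form ⌊ B ⌋ ⟦ x₂ ⟧ ⟦ x₂ ⟧)))) ⟩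
    ∑ᶜ m (λ x₁ → ∑ᶜ n (λ x₂ → χ (red (form ⌊ A ⌋ ⟦ x₁ ⟧ ⟦ x₁ ⟧)) * χ (red (form ⌊ B ⌋ ⟦ x₂ ⟧ ⟦ x₂ ⟧))))
      ≈⟨ ∑ᶜ-product m n _ _ ⟩
    Γ χ ⌊ A ⌋ * Γ χ ⌊ B ⌋ ∎

  Β-⊕ : ∀ {χ} → IsCharacter χ → ∀ {m n} (A : Mat m m) (B : Mat n n) →
        Β χ ⌊ A ⊕ B ⌋ ≃ Β χ ⌊ A ⌋ * Β χ ⌊ B ⌋
  Β-⊕ {χ} hom {m} {n} A B = begin
    ∑ᶜ (m ℕ.+ n) (λ x → ∑ᶜ (m ℕ.+ n) (λ y → χ (red (form ⌊ A ⊕ B ⌋ ⟦ x ⟧ ⟦ y ⟧))))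
      ≈⟨ ∑ᶜ-++ m n _ ⟩
    ∑ᶜ m (λ x₁ → ∑ᶜ n (λ x₂ → ∑ᶜ (m ℕ.+ n) (λ y → χ (red (form ⌊ A ⊕ B ⌋ ⟦ x₁ ++ x₂ ⟧ ⟦ y ⟧)))))
      ≈⟨ ∑ᶜ-cong m (λ x₁ → ∑ᶜ-cong n (λ x₂ → ∑ᶜ-++ m n _)) ⟩
    ∑ᶜ m (λ x₁ → ∑ᶜ n (λ x₂ → ∑ᶜ m (λ y₁ → ∑ᶜ n (λ y₂ → χ (red (form ⌊ A ⊕ B ⌋ ⟦ x₁ ++ x₂ ⟧ ⟦ y₁ ++ y₂ ⟧))))))
      ≈⟨ ∑ᶜ-cong m (λ x₁ → ∑ᶜ-cong n (λ x₂ → ∑ᶜ-cong m (λ y₁ → ∑ᶜ-cong n (λ y₂ → ≃-trans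
           (≃-reflexive (cong (λ q → χ (red q)) (form-++ A B x₁ y₁ x₂ y₂)))
           (character-ℤ hom (form ⌊ A ⌋ ⟦ x₁ ⟧ ⟦ y₁ ⟧) (form ⌊ B ⌋ ⟦ x₂ ⟧ ⟦ y₂ ⟧)))))) ⟩
    ∑ᶜ m (λ x₁ → ∑ᶜ n (λ x₂ → ∑ᶜ m (λ y₁ → ∑ᶜ n (λ y₂ → f x₁ y₁ * g x₂ y₂))))
      ≈⟨ ∑ᶜ-cong m (λ x₁ → ∑ᶜ-comm n m (λ x₂ y₁ → ∑ᶜ n (λ y₂ → f x₁ y₁ * g x₂ y₂))) ⟩
    ∑ᶜ m (λ x₁ → ∑ᶜ m (λ y₁ → ∑ᶜ n (λ x₂ → ∑ᶜ n (λ y₂ → f x₁ y₁ * g x₂ y₂))))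
      ≈⟨ ∑ᶜ-cong m (λ x₁ → ∑ᶜ-cong m (λ y₁ → ∑ᶜ-cong n (λ x₂ → ∑ᶜ-*ˡ n (f x₁ y₁) (g x₂)))) ⟩
    ∑ᶜ m (λ x₁ → ∑ᶜ m (λ y₁ → ∑ᶜ n (λ x₂ → f x₁ y₁ * ∑ᶜ n (g x₂))))
      ≈⟨ ∑ᶜ-cong m (λ x₁ → ∑ᶜ-cong m (λ y₁ → ∑ᶜ-*ˡ n (f x₁ y₁) (λ x₂ → ∑ᶜ n (g x₂)))) ⟩
    ∑ᶜ m (λ x₁ → ∑ᶜ m (λ y₁ → f x₁ y₁ * Β χ ⌊ B ⌋))
      ≈⟨ ∑ᶜ-cong m (λ x₁ → ∑ᶜ-*ʳ m (Β χ ⌊ B ⌋) (f x₁)) ⟩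
    ∑ᶜ m (λ x₁ → ∑ᶜ m (f x₁) * Β χ ⌊ B ⌋)
      ≈⟨ ∑ᶜ-*ʳ m (Β χ ⌊ B ⌋) (λ x₁ → ∑ᶜ m (f x₁)) ⟩
    Β χ ⌊ A ⌋ * Β χ ⌊ B ⌋ ∎
    where f : Cube m → Cube m → Carrier
          f x₁ y₁ = χ (red (form ⌊ A ⌋ ⟦ x₁ ⟧ ⟦ y₁ ⟧))
          g : Cube n → Cube n → Carrier
          g x₂ y₂ = χ (red (form ⌊ B ⌋ ⟦ x₂ ⟧ ⟦ y₂ ⟧))

-- The Gaussian integers a + b·i.  Gauss sums of the characters of ℤ/4
-- take their values here.
infix 8 _⊹_
record ℤ[i] : Set where
  constructor _⊹_
  field re im : ℤ

-- the real Gaussian integers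
real : ℤ → ℤ[i]
real a = a ⊹ 0ℤ

infixl 6 _+ᵢ_
infixl 7 _*ᵢ_
_+ᵢ_ _*ᵢ_ : ℤ[i] → ℤ[i] → ℤ[i]
(a ⊹ b) +ᵢ (c ⊹ d) = (a ℤ.+ c) ⊹ (b ℤ.+ d)
(a ⊹ b) *ᵢ (c ⊹ d) = (a ℤ.* c ℤ.- b ℤ.* d) ⊹ (a ℤ.* d ℤ.+ b ℤ.* c)

-- real numbers multiply as integers
real-* : ∀ a b → real a *ᵢ real b ≡ real (a ℤ.* b)
real-* a b = cong₂ _⊹_ (reᵖ a b) (imᵖ a b)
  where reᵖ : ∀ a b → a ℤ.* b ℤ.- 0ℤ ℤ.* 0ℤ ≡ a ℤ.* b
        reᵖ = ℤ-Solver.solve-∀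
        imᵖ : ∀ a b → a ℤ.* 0ℤ ℤ.+ 0ℤ ℤ.* b ≡ 0ℤ
        imᵖ = ℤ-Solver.solve-∀

real-injective : ∀ {a b} → real a ≡ real b → a ≡ b
real-injective = cong ℤ[i].re

-- The laws of ℤ[i]; the multiplicative ones are polynomial identities between
-- real and imaginary parts.
+ᵢ-assoc : ∀ x y z → (x +ᵢ y) +ᵢ z ≡ x +ᵢ (y +ᵢ z)
+ᵢ-assoc (a ⊹ b) (c ⊹ d) (e ⊹ f) = cong₂ _⊹_ (ℤₚ.+-assoc a c e) (ℤₚ.+-assoc b d f)

+ᵢ-identityˡ : ∀ x → real 0ℤ +ᵢ x ≡ x
+ᵢ-identityˡ (a ⊹ b) = cong₂ _⊹_ (ℤₚ.+-identityˡ a) (ℤₚ.+-identityˡ b)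

+ᵢ-comm : ∀ x y → x +ᵢ y ≡ y +ᵢ x
+ᵢ-comm (a ⊹ b) (c ⊹ d) = cong₂ _⊹_ (ℤₚ.+-comm a c) (ℤₚ.+-comm b d)

*ᵢ-assoc : ∀ x y z → (x *ᵢ y) *ᵢ z ≡ x *ᵢ (y *ᵢ z)
*ᵢ-assoc (a ⊹ b) (c ⊹ d) (e ⊹ f) = cong₂ _⊹_ (reᵃ a b c d e f) (imᵃ a b c d e f)
  where reᵃ : ∀ a b c d e f → (a ℤ.* c ℤ.- b ℤ.* d) ℤ.* e ℤ.- (a ℤ.* d ℤ.+ b ℤ.* c) ℤ.* f
                            ≡ a ℤ.* (c ℤ.* e ℤ.- d ℤ.* f) ℤ.- b ℤ.* (c ℤ.* f ℤ.+ d ℤ.* e)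
        reᵃ = ℤ-Solver.solve-∀
        imᵃ : ∀ a b c d e f → (a ℤ.* c ℤ.- b ℤ.* d) ℤ.* f ℤ.+ (a ℤ.* d ℤ.+ b ℤ.* c) ℤ.* e
                            ≡ a ℤ.* (c ℤ.* f ℤ.+ d ℤ.* e) ℤ.+ b ℤ.* (c ℤ.* e ℤ.- d ℤ.* f)
        imᵃ = ℤ-Solver.solve-∀

*ᵢ-identityˡ : ∀ x → real 1ℤ *ᵢ x ≡ x
*ᵢ-identityˡ (a ⊹ b) = cong₂ _⊹_ (reᵘ a b) (imᵘ a b)
  where reᵘ : ∀ a b → 1ℤ ℤ.* a ℤ.- 0ℤ ℤ.* b ≡ a
        reᵘ = ℤ-Solver.solve-∀
        imᵘ : ∀ a b → 1ℤ ℤ.* b ℤ.+ 0ℤ ℤ.* a ≡ b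
        imᵘ = ℤ-Solver.solve-∀

*ᵢ-comm : ∀ x y → x *ᵢ y ≡ y *ᵢ x
*ᵢ-comm (a ⊹ b) (c ⊹ d) = cong₂ _⊹_ (reᶜ a b c d) (imᶜ a b c d)
  where reᶜ : ∀ a b c d → a ℤ.* c ℤ.- b ℤ.* d ≡ c ℤ.* a ℤ.- d ℤ.* b
        reᶜ = ℤ-Solver.solve-∀
        imᶜ : ∀ a b c d → a ℤ.* d ℤ.+ b ℤ.* c ≡ c ℤ.* b ℤ.+ d ℤ.* a
        imᶜ = ℤ-Solver.solve-∀

*ᵢ-distribʳ : ∀ z x y → (x +ᵢ y) *ᵢ z ≡ x *ᵢ z +ᵢ y *ᵢ z
*ᵢ-distribʳ (e ⊹ f) (a ⊹ b) (c ⊹ d) = cong₂ _⊹_ (reᵈ a b c d e f) (imᵈ a b c d e f)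
  where reᵈ : ∀ a b c d e f → (a ℤ.+ c) ℤ.* e ℤ.- (b ℤ.+ d) ℤ.* f ≡ (a ℤ.* e ℤ.- b ℤ.* f) ℤ.+ (c ℤ.* e ℤ.- d ℤ.* f)
        reᵈ = ℤ-Solver.solve-∀
        imᵈ : ∀ a b c d e f → (a ℤ.+ c) ℤ.* f ℤ.+ (b ℤ.+ d) ℤ.* e ≡ (a ℤ.* f ℤ.+ b ℤ.* e) ℤ.+ (c ℤ.* f ℤ.+ d ℤ.* e)
        imᵈ = ℤ-Solver.solve-∀

*ᵢ-zeroˡ : ∀ x → real 0ℤ *ᵢ x ≡ real 0ℤ
*ᵢ-zeroˡ (a ⊹ b) = cong₂ _⊹_ (reᶻ a b) (imᶻ a b)
  where reᶻ : ∀ a b → 0ℤ ℤ.* a ℤ.- 0ℤ ℤ.* b ≡ 0ℤ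
        reᶻ = ℤ-Solver.solve-∀
        imᶻ : ∀ a b → 0ℤ ℤ.* b ℤ.+ 0ℤ ℤ.* a ≡ 0ℤ
        imᶻ = ℤ-Solver.solve-∀

*ᵢ-zeroʳ : ∀ x → x *ᵢ real 0ℤ ≡ real 0ℤ
*ᵢ-zeroʳ x = trans (*ᵢ-comm x (real 0ℤ)) (*ᵢ-zeroˡ x)

ℤ[i]-commutativeSemiring : CommutativeSemiring 0ℓ 0ℓ
ℤ[i]-commutativeSemiring = record
  { _+_ = _+ᵢ_ ; _*_ = _*ᵢ_ ; 0# = real 0ℤ ; 1# = real 1ℤ
  ; isCommutativeSemiring = isCommutativeSemiringˡ record
    { +-isCommutativeMonoid = isCommutativeMonoidˡ record
        { isSemigroup = semigroup _+ᵢ_ +ᵢ-assoc ; identityˡ = +ᵢ-identityˡ ; comm = +ᵢ-comm }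
    ; *-isCommutativeMonoid = isCommutativeMonoidˡ record
        { isSemigroup = semigroup _*ᵢ_ *ᵢ-assoc ; identityˡ = *ᵢ-identityˡ ; comm = *ᵢ-comm }
    ; distribʳ              = *ᵢ-distribʳ
    ; zeroˡ                 = *ᵢ-zeroˡ
    } }
  where
  semigroup : ∀ _∙_ → (∀ x y z → (x ∙ y) ∙ z ≡ x ∙ (y ∙ z)) → IsSemigroup {A = ℤ[i]} _≡_ _∙_
  semigroup _∙_ assoc = record { isMagma = ≡-isMagma _∙_ ; assoc = assoc }

-- From now on Gauss sums take values in ℤ[i].
open GaussSums ℤ[i]-commutativeSemiring
  using (Γ; Β; IsCharacter; Γ-cong₄; Β-cong₄; Γ-⊕; Β-⊕; Γ-isometry; Β-isometry)

-- Decidable equality of Gaussian integers, used for finite checks.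
infix 4 _≟ᵢ_
_≟ᵢ_ : DecidableEquality ℤ[i]
(a ⊹ b) ≟ᵢ (c ⊹ d) = map′ (λ (a≡c , b≡d) → cong₂ _⊹_ a≡c b≡d) (λ { refl → refl , refl })
                          ((a ℤ.≟ c) ×-dec (b ℤ.≟ d))

-- The characters u ↦ 1, u ↦ (-1)ᵘ and u ↦ iᵘ of ℤ/4.
χ₁ χ₋ χᵢ : Fin 4 → ℤ[i]
χ₁ _ = real 1ℤ
χ₋ = Vec.lookup (real 1ℤ ∷ real -1ℤ ∷ real 1ℤ ∷ real -1ℤ ∷ [])
χᵢ = Vec.lookup (real 1ℤ ∷ 0ℤ ⊹ 1ℤ ∷ real -1ℤ ∷ 0ℤ ⊹ -1ℤ ∷ [])

-- being a character is a finite check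
character? : ∀ χ → Dec (IsCharacter χ)
character? χ = Finₚ.all? λ u → Finₚ.all? λ w → χ (red (toℤ u ℤ.+ toℤ w)) ≟ᵢ χ u *ᵢ χ w

χ₁-character : IsCharacter χ₁
χ₁-character = toWitness {a? = character? χ₁} _

χ₋-character : IsCharacter χ₋
χ₋-character = toWitness {a? = character? χ₋} _

χᵢ-character : IsCharacter χᵢ
χᵢ-character = toWitness {a? = character? χᵢ} _

-- the number of points of (ℤ/4)^rank of a term
card : Term → ℕ
card t = 4 ℕ.^ dimK (kind t)

-- scales 4, 8, 16, … vanish modulo 4
scale≡₄0 : ∀ e → sc (2 ℕ.+ e) ≡₄ 0ℤ
scale≡₄0 e = by4∣ (divides (+ (2 ℕ.^ e))
  (trans (ℤₚ.+-identityʳ _) (trans (cong +_ (four (2 ℕ.^ e))) (ℤₚ.pos-* (2 ℕ.^ e) 4))))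
  where four : ∀ a → 2 ℕ.* (2 ℕ.* a) ≡ a ℕ.* 4
        four = ℕ-Solver.solve-∀

-- and so are their multiples
multiple : ∀ e c → c ℤ.* sc (2 ℕ.+ e) ≡₄ 0ℤ
multiple e c = ≡₄-trans (≡₄-* (≡₄-refl {c}) (scale≡₄0 e)) (≡₄-reflexive (ℤₚ.*-zeroʳ c))

-- a term of scale at least 4 has Gram matrix ≡ 0 modulo 4
deep-entries : ∀ e s k i j → ⌊ termGram (term (2 ℕ.+ e) s k) ⌋ i j ≡₄ 0ℤ
deep-entries e Sign.+ typeII    zero    zero    = ≡₄-refl
deep-entries e Sign.+ typeII    zero    (suc _) = scale≡₄0 e
deep-entries e Sign.+ typeII    (suc _) zero    = scale≡₄0 e
deep-entries e Sign.+ typeII    (suc _) (suc _) = ≡₄-refl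
deep-entries e Sign.- typeII    zero    zero    = multiple e (+ 2)
deep-entries e Sign.- typeII    zero    (suc _) = scale≡₄0 e
deep-entries e Sign.- typeII    (suc _) zero    = scale≡₄0 e
deep-entries e Sign.- typeII    (suc _) (suc _) = multiple e (+ 2)
deep-entries e Sign.+ (typeI G) zero    zero    = scale≡₄0 e
deep-entries e Sign.- (typeI G) zero    zero    = ≡₄-trans (≡₄-reflexive (ℤₚ.neg-distribˡ-* (+ 3) (sc (2 ℕ.+ e)))) (multiple e (ℤ.- + 3))
deep-entries e Sign.+ (typeI R) zero    zero    = ≡₄-trans (≡₄-reflexive (sym (ℤₚ.-1*i≡-i (sc (2 ℕ.+ e))))) (multiple e -1ℤ)
deep-entries e Sign.- (typeI R) zero    zero    = multiple e (+ 3)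

-- so its Gauss sums are those of the zero form
Γ-deep : ∀ χ e s k → Γ χ ⌊ termGram (term (2 ℕ.+ e) s k) ⌋ ≡ Γ χ {dimK k} (λ _ _ → 0ℤ)
Γ-deep χ e s k = Γ-cong₄ χ (deep-entries e s k)

Β-deep : ∀ χ e s k → Β χ ⌊ termGram (term (2 ℕ.+ e) s k) ⌋ ≡ Β χ {dimK k} (λ _ _ → 0ℤ)
Β-deep χ e s k = Β-cong₄ χ (deep-entries e s k)

-- The tables below are evaluations of finite sums.

-- the trivial character counts points
Γ₁-term : ∀ t → Γ χ₁ ⌊ termGram t ⌋ ≡ real (+ card t)
Γ₁-term (term e s typeII)    = refl
Γ₁-term (term e s (typeI l)) = refl

-- the sign character detects the type I terms of scale 1 ...
Γ₋-odd : ∀ t → exp t ≡ 0 → IsTypeI t → Γ χ₋ ⌊ termGram t ⌋ ≡ real 0ℤ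
Γ₋-odd (term 0 Sign.+ (typeI G)) _ _ = refl
Γ₋-odd (term 0 Sign.- (typeI G)) _ _ = refl
Γ₋-odd (term 0 Sign.+ (typeI R)) _ _ = refl
Γ₋-odd (term 0 Sign.- (typeI R)) _ _ = refl
Γ₋-odd (term 0 s typeII)         _ (_ , ())
Γ₋-odd (term (suc _) _ _)       () _

-- ... and counts points on all other terms
Γ₋-term : ∀ t → (exp t ≡ 0 → IsTypeII t) → Γ χ₋ ⌊ termGram t ⌋ ≡ real (+ card t)
Γ₋-term (term 0 Sign.+ typeII)    _ = refl
Γ₋-term (term 0 Sign.- typeII)    _ = refl
Γ₋-term (term 0 s (typeI l))   even with even refl
... | ()
Γ₋-term (term 1 Sign.+ typeII)    _ = refl
Γ₋-term (term 1 Sign.- typeII)    _ = refl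
Γ₋-term (term 1 Sign.+ (typeI G)) _ = refl
Γ₋-term (term 1 Sign.- (typeI G)) _ = refl
Γ₋-term (term 1 Sign.+ (typeI R)) _ = refl
Γ₋-term (term 1 Sign.- (typeI R)) _ = refl
Γ₋-term (term (suc (suc e)) s typeII)    _ = Γ-deep χ₋ e s typeII
Γ₋-term (term (suc (suc e)) s (typeI l)) _ = Γ-deep χ₋ e s (typeI l)

-- the character iᵘ sees the sign of a type II term of scale 1 ...
Γᵢ-hyperbolic : ∀ s → Γ χᵢ ⌊ termGram (term 0 s typeII) ⌋ ≡ real (s ◃ 8)
Γᵢ-hyperbolic Sign.+ = refl
Γᵢ-hyperbolic Sign.- = refl

-- ... and counts points on the terms which are not of type I of scale 1 or 2
Γᵢ-term : ∀ t → ¬ exp t ≡ 0 → ¬ (exp t ≡ 1 × IsTypeI t) → Γ χᵢ ⌊ termGram t ⌋ ≡ real (+ card t)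
Γᵢ-term (term 0 s k)                     exp≢0 _ = ⊥-elim (exp≢0 refl)
Γᵢ-term (term 1 Sign.+ typeII)           _     _ = refl
Γᵢ-term (term 1 Sign.- typeII)           _     _ = refl
Γᵢ-term (term 1 s (typeI l))             _   ¬I₁ = ⊥-elim (¬I₁ (refl , l , refl))
Γᵢ-term (term (suc (suc e)) s typeII)    _     _ = Γ-deep χᵢ e s typeII
Γᵢ-term (term (suc (suc e)) s (typeI l)) _     _ = Γ-deep χᵢ e s (typeI l)

-- the sign character on the bilinear form sees the terms of scale 1 ...
Β₋-hyperbolic : ∀ s → Β χ₋ ⌊ termGram (term 0 s typeII) ⌋ ≡ real (+ 64)
Β₋-hyperbolic Sign.+ = refl
Β₋-hyperbolic Sign.- = refl

-- ... and counts pairs of points on all other terms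
Β₋-term : ∀ t → ¬ exp t ≡ 0 → Β χ₋ ⌊ termGram t ⌋ ≡ real (+ (card t ℕ.* card t))
Β₋-term (term 0 s k)                     exp≢0 = ⊥-elim (exp≢0 refl)
Β₋-term (term 1 Sign.+ typeII)           _ = refl
Β₋-term (term 1 Sign.- typeII)           _ = refl
Β₋-term (term 1 Sign.+ (typeI G))        _ = refl
Β₋-term (term 1 Sign.- (typeI G))        _ = refl
Β₋-term (term 1 Sign.+ (typeI R))        _ = refl
Β₋-term (term 1 Sign.- (typeI R))        _ = refl
Β₋-term (term (suc (suc e)) s typeII)    _ = Β-deep χ₋ e s typeII
Β₋-term (term (suc (suc e)) s (typeI l)) _ = Β-deep χ₋ e s (typeI l)

-- Relations between a real Gauss sum z and a number of points w which
-- are preserved by products.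
record Multiplicative (Rel : ℤ → ℕ → Set) : Set where
  field
    unit : Rel 1ℤ 1
    mult : ∀ {z₁ z₂ w₁ w₂} → Rel z₁ w₁ → Rel z₂ w₂ → Rel (z₁ ℤ.* z₂) (w₁ ℕ.* w₂)

-- z = w
Exact : ℤ → ℕ → Set
Exact z w = z ≡ + w

exact : Multiplicative Exact
exact = record
  { unit = refl
  ; mult = λ {_} {_} {w₁} {w₂} z₁≡w₁ z₂≡w₂ → trans (cong₂ ℤ._*_ z₁≡w₁ z₂≡w₂) (sym (ℤₚ.pos-* w₁ w₂)) }

-- z = w²
ExactSquare : ℤ → ℕ → Set
ExactSquare z w = z ≡ + (w ℕ.* w)

exactSquare : Multiplicative ExactSquare
exactSquare = record
  { unit = refl
  ; mult = λ {_} {_} {w₁} {w₂} z₁≡w₁² z₂≡w₂² →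
      trans (Multiplicative.mult exact z₁≡w₁² z₂≡w₂²) (cong +_ (square-* w₁ w₂)) }
  where square-* : ∀ a b → a ℕ.* a ℕ.* (b ℕ.* b) ≡ a ℕ.* b ℕ.* (a ℕ.* b)
        square-* = ℕ-Solver.solve-∀

-- 0 ≤ z ≤ w²
BoundedSquare : ℤ → ℕ → Set
BoundedSquare z w = Σ[ b ∈ ℕ ] z ≡ + b × b ≤ w ℕ.* w

boundedSquare : Multiplicative BoundedSquare
boundedSquare = record
  { unit = 1 , refl , ℕₚ.≤-refl
  ; mult = λ { {w₁ = w₁} {w₂} (b₁ , refl , b₁≤w₁²) (b₂ , refl , b₂≤w₂²) →
      b₁ ℕ.* b₂ , sym (ℤₚ.pos-* b₁ b₂) ,
      ℕₚ.≤-trans (ℕₚ.*-mono-≤ b₁≤w₁² b₂≤w₂²) (ℕₚ.≤-reflexive (square-* w₁ w₂)) } }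
  where square-* : ∀ a b → a ℕ.* a ℕ.* (b ℕ.* b) ≡ a ℕ.* b ℕ.* (a ℕ.* b)
        square-* = ℕ-Solver.solve-∀

-- z = w, or |z| ≤ w/2
WholeOrHalf : ℤ → ℕ → Set
WholeOrHalf z w = z ≡ + w ⊎ 2 ℕ.* ℤ.∣ z ∣ ≤ w

wholeOrHalf : Multiplicative WholeOrHalf
wholeOrHalf = record { unit = inj₁ refl ; mult = mult }
  where
  mult : ∀ {z₁ z₂ w₁ w₂} → WholeOrHalf z₁ w₁ → WholeOrHalf z₂ w₂ → WholeOrHalf (z₁ ℤ.* z₂) (w₁ ℕ.* w₂)
  mult (inj₁ z₁≡w₁) (inj₁ z₂≡w₂) = inj₁ (Multiplicative.mult exact z₁≡w₁ z₂≡w₂)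
  mult {z₂ = z₂} {w₁} {w₂} (inj₁ refl) (inj₂ 2∣z₂∣≤w₂) = inj₂ (begin
    2 ℕ.* ℤ.∣ + w₁ ℤ.* z₂ ∣      ≡⟨ cong (2 ℕ.*_) (ℤₚ.abs-* (+ w₁) z₂) ⟩
    2 ℕ.* (w₁ ℕ.* ℤ.∣ z₂ ∣)      ≡⟨ swap w₁ ℤ.∣ z₂ ∣ ⟩
    w₁ ℕ.* (2 ℕ.* ℤ.∣ z₂ ∣)      ≤⟨ ℕₚ.*-monoʳ-≤ w₁ 2∣z₂∣≤w₂ ⟩
    w₁ ℕ.* w₂                    ∎)
    where open ℕₚ.≤-Reasoning
          swap : ∀ a b → 2 ℕ.* (a ℕ.* b) ≡ a ℕ.* (2 ℕ.* b)
          swap = ℕ-Solver.solve-∀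
  mult {z₁ = z₁} {_} {w₁} {w₂} (inj₂ 2∣z₁∣≤w₁) (inj₁ refl) = inj₂ (begin
    2 ℕ.* ℤ.∣ z₁ ℤ.* + w₂ ∣      ≡⟨ cong (2 ℕ.*_) (ℤₚ.abs-* z₁ (+ w₂)) ⟩
    2 ℕ.* (ℤ.∣ z₁ ∣ ℕ.* w₂)      ≡⟨ ℕₚ.*-assoc 2 ℤ.∣ z₁ ∣ w₂ ⟨
    2 ℕ.* ℤ.∣ z₁ ∣ ℕ.* w₂        ≤⟨ ℕₚ.*-monoˡ-≤ w₂ 2∣z₁∣≤w₁ ⟩
    w₁ ℕ.* w₂                    ∎)
    where open ℕₚ.≤-Reasoning
  mult {z₁} {z₂} {w₁} {w₂} (inj₂ 2∣z₁∣≤w₁) (inj₂ 2∣z₂∣≤w₂) = inj₂ (begin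
    2 ℕ.* ℤ.∣ z₁ ℤ.* z₂ ∣        ≡⟨ cong (2 ℕ.*_) (ℤₚ.abs-* z₁ z₂) ⟩
    2 ℕ.* (ℤ.∣ z₁ ∣ ℕ.* ℤ.∣ z₂ ∣) ≡⟨ ℕₚ.*-assoc 2 ℤ.∣ z₁ ∣ ℤ.∣ z₂ ∣ ⟨
    2 ℕ.* ℤ.∣ z₁ ∣ ℕ.* ℤ.∣ z₂ ∣  ≤⟨ ℕₚ.*-mono-≤ 2∣z₁∣≤w₁ (ℕₚ.≤-trans (ℕₚ.m≤n*m ℤ.∣ z₂ ∣ 2) 2∣z₂∣≤w₂) ⟩
    w₁ ℕ.* w₂                    ∎)
    where open ℕₚ.≤-Reasoning

-- On a term which is not of type I of scale 1, Γᵢ is real and equal to the number of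
-- points or at most half of it.
Γᵢ-bound : ∀ t → (exp t ≡ 0 → IsTypeII t) → Σ[ z ∈ ℤ ] Γ χᵢ ⌊ termGram t ⌋ ≡ real z × WholeOrHalf z (card t)
Γᵢ-bound (term 0 Sign.+ typeII) _ = + 8 , refl , inj₂ ℕₚ.≤-refl
Γᵢ-bound (term 0 Sign.- typeII) _ = ℤ.- + 8 , refl , inj₂ ℕₚ.≤-refl
Γᵢ-bound (term 0 s (typeI l)) even with even refl
... | ()
Γᵢ-bound (term 1 Sign.+ (typeI G)) _ = 0ℤ , refl , inj₂ z≤n
Γᵢ-bound (term 1 Sign.- (typeI G)) _ = 0ℤ , refl , inj₂ z≤n
Γᵢ-bound (term 1 Sign.+ (typeI R)) _ = 0ℤ , refl , inj₂ z≤n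
Γᵢ-bound (term 1 Sign.- (typeI R)) _ = 0ℤ , refl , inj₂ z≤n
Γᵢ-bound t@(term 1 s typeII)       _ = + card t , Γᵢ-term t (λ ()) (λ { (_ , _ , ()) }) , inj₁ refl
Γᵢ-bound t@(term (suc (suc e)) s k) _ = + card t , Γᵢ-term t (λ ()) (λ { (() , _) }) , inj₁ refl

-- the bilinear Gauss sum of a term is a natural number at most (its number of points)²
Β₋-bound : ∀ t → Σ[ z ∈ ℤ ] Β χ₋ ⌊ termGram t ⌋ ≡ real z × BoundedSquare z (card t)
Β₋-bound (term 0 s typeII)            = + 64 , Β₋-hyperbolic s , 64 , refl , ℕₚ.m≤m+n 64 192
Β₋-bound (term 0 Sign.+ (typeI G))    = + 8 , refl , 8 , refl , ℕₚ.m≤m+n 8 8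
Β₋-bound (term 0 Sign.- (typeI G))    = + 8 , refl , 8 , refl , ℕₚ.m≤m+n 8 8
Β₋-bound (term 0 Sign.+ (typeI R))    = + 8 , refl , 8 , refl , ℕₚ.m≤m+n 8 8
Β₋-bound (term 0 Sign.- (typeI R))    = + 8 , refl , 8 , refl , ℕₚ.m≤m+n 8 8
Β₋-bound t@(term (suc e) s k)         = _ , Β₋-term t (λ ()) , _ , refl , ℕₚ.≤-refl

-- the number of points of (ℤ/4)^rank of a symbol
cards : List Term → ℕ
cards []      = 1
cards (t ∷ F) = card t ℕ.* cards F

cards-nonZero : ∀ F → ℕ.NonZero (cards F)
cards-nonZero []      = _
cards-nonZero (t ∷ F) = ℕₚ.m*n≢0 (card t) (cards F) {{ℕₚ.m^n≢0 4 (dimK (kind t))}} {{cards-nonZero F}}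

-- a real value of a term that is related to its number of points
RealRelated : (Term → ℤ[i]) → (ℤ → ℕ → Set) → Term → Set
RealRelated v Rel t = Σ[ z ∈ ℤ ] v t ≡ real z × Rel z (card t)

-- A value V of symbols that is the product of the values v of their terms.
module Factorisation (V : List Term → ℤ[i]) (v : Term → ℤ[i])
                     (V-[] : V [] ≡ real 1ℤ) (V-∷ : ∀ t F → V (t ∷ F) ≡ v t *ᵢ V F) where

  -- if every term has a real value related to its number of points, so has the symbol
  factor-all : ∀ {Rel} → Multiplicative Rel → ∀ F → (∀ k → RealRelated v Rel (lookup F k)) →
               Σ[ Z ∈ ℤ ] V F ≡ real Z × Rel Z (cards F)
  factor-all M []      _     = 1ℤ , V-[] , Multiplicative.unit M
  factor-all M (t ∷ F) terms with terms zero | factor-all M F (λ k → terms (suc k))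
  ... | z , vt≡z , Rz | Z , VF≡Z , RZ =
    z ℤ.* Z , trans (V-∷ t F) (trans (cong₂ _*ᵢ_ vt≡z VF≡Z) (real-* z Z)) , Multiplicative.mult M Rz RZ

  -- when every term has value f (card t) for a multiplicative f
  factor-exact : ∀ (f : ℕ → ℕ) → Multiplicative (λ z w → z ≡ + f w) →
                 ∀ F → (∀ k → v (lookup F k) ≡ real (+ f (card (lookup F k)))) → V F ≡ real (+ f (cards F))
  factor-exact f M F terms = value (factor-all M F (λ k → _ , terms k , refl))
    where value : Σ[ Z ∈ ℤ ] V F ≡ real Z × Z ≡ + f (cards F) → V F ≡ real (+ f (cards F))
          value (Z , VF≡Z , Z≡) = trans VF≡Z (cong real Z≡)

  -- V F = v (F[i]) · Z with Rel Z W, where F has card (F[i]) · W points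
  Split : (ℤ → ℕ → Set) → (F : List Term) → Fin (length F) → Set
  Split Rel F i = Σ[ Z ∈ ℤ ] Σ[ W ∈ ℕ ]
    V F ≡ v (lookup F i) *ᵢ real Z × cards F ≡ card (lookup F i) ℕ.* W × Rel Z W

  -- splitting off the term at position i
  factor-one : ∀ {Rel} → Multiplicative Rel → ∀ F i → (∀ k → ¬ k ≡ i → RealRelated v Rel (lookup F k)) →
               Split Rel F i
  factor-one M (t ∷ F) zero others with factor-all M F (λ k → others (suc k) λ ())
  ... | Z , VF≡Z , RZ = Z , cards F , trans (V-∷ t F) (cong (v t *ᵢ_) VF≡Z) , refl , RZ
  factor-one M (t ∷ F) (suc i) others
    with others zero (λ ()) | factor-one M F i (λ k k≢i → others (suc k) (λ k+1≡i+1 → k≢i (Finₚ.suc-injective k+1≡i+1)))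
  ... | z , vt≡z , Rz | Z , W , VF≡ , cards≡ , RZ = z ℤ.* Z , card t ℕ.* W ,
    (begin
      V (t ∷ F)                                ≡⟨ V-∷ t F ⟩
      v t *ᵢ V F                               ≡⟨ cong₂ _*ᵢ_ vt≡z VF≡ ⟩
      real z *ᵢ (v (lookup F i) *ᵢ real Z)     ≡⟨ *ᵢ-assoc (real z) _ _ ⟨
      real z *ᵢ v (lookup F i) *ᵢ real Z       ≡⟨ cong (_*ᵢ real Z) (*ᵢ-comm (real z) _) ⟩
      v (lookup F i) *ᵢ real z *ᵢ real Z       ≡⟨ *ᵢ-assoc (v (lookup F i)) _ _ ⟩
      v (lookup F i) *ᵢ (real z *ᵢ real Z)     ≡⟨ cong (v (lookup F i) *ᵢ_) (real-* z Z) ⟩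
      v (lookup F i) *ᵢ real (z ℤ.* Z)         ∎) ,
    trans (cong (card t ℕ.*_) cards≡) (rotate (card t) (card (lookup F i)) W) ,
    Multiplicative.mult M Rz RZ
    where open ≡-Reasoning
          rotate : ∀ a b c → a ℕ.* (b ℕ.* c) ≡ b ℕ.* (a ℕ.* c)
          rotate = ℕ-Solver.solve-∀

  -- a vanishing factor
  factor-zero : ∀ F k → v (lookup F k) ≡ real 0ℤ → V F ≡ real 0ℤ
  factor-zero (t ∷ F) zero    vt≡0 = trans (V-∷ t F) (trans (cong (_*ᵢ V F) vt≡0) (*ᵢ-zeroˡ (V F)))
  factor-zero (t ∷ F) (suc k) vk≡0 = trans (V-∷ t F) (trans (cong (v t *ᵢ_) (factor-zero F k vk≡0)) (*ᵢ-zeroʳ (v t)))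

-- Gauss sums of the lattice given by a fine symbol
Γˢ : (Fin 4 → ℤ[i]) → List Term → ℤ[i]
Γˢ χ F = Γ χ ⌊ symGram F ⌋

Β₋ˢ : List Term → ℤ[i]
Β₋ˢ F = Β χ₋ ⌊ symGram F ⌋

-- the Gauss sums used below factor over the terms of a symbol
module Γ₁ˢ = Factorisation (Γˢ χ₁) (λ t → Γ χ₁ ⌊ termGram t ⌋) refl (λ t F → Γ-⊕ {χ₁} χ₁-character (termGram t) (symGram F))
module Γ₋ˢ = Factorisation (Γˢ χ₋) (λ t → Γ χ₋ ⌊ termGram t ⌋) refl (λ t F → Γ-⊕ {χ₋} χ₋-character (termGram t) (symGram F))
module Γᵢˢ = Factorisation (Γˢ χᵢ) (λ t → Γ χᵢ ⌊ termGram t ⌋) refl (λ t F → Γ-⊕ {χᵢ} χᵢ-character (termGram t) (symGram F))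
module Β₋ˢ = Factorisation Β₋ˢ (λ t → Β χ₋ ⌊ termGram t ⌋) refl (λ t F → Β-⊕ {χ₋} χ₋-character (termGram t) (symGram F))

-- Fine symbols of the same lattice have the same Gauss sums.
Γˢ-invariant : ∀ L F F′ → FineSymbolFor L F → FineSymbolFor L F′ → ∀ χ → Γˢ χ F ≡ Γˢ χ F′
Γˢ-invariant L F F′ (_ , iso) (_ , iso′) χ =
  trans (sym (Γ-isometry χ (residueIsometry (gram L) (symGram F) iso)))
        (Γ-isometry χ (residueIsometry (gram L) (symGram F′) iso′))

Β₋ˢ-invariant : ∀ L F F′ → FineSymbolFor L F → FineSymbolFor L F′ → Β₋ˢ F ≡ Β₋ˢ F′
Β₋ˢ-invariant L F F′ (_ , iso) (_ , iso′) =
  trans (sym (Β-isometry χ₋ (residueIsometry (gram L) (symGram F) iso)))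
        (Β-isometry χ₋ (residueIsometry (gram L) (symGram F′) iso′))

-- the trivial character counts the points (ℤ/4)^rank
Γ₁-symbol : ∀ F → Γˢ χ₁ F ≡ real (+ cards F)
Γ₁-symbol F = Γ₁ˢ.factor-exact (λ w → w) exact F (λ k → Γ₁-term (lookup F k))

-- all terms of scale 1 have type II
EvenUnimodular : List Term → Set
EvenUnimodular F = ∀ k → exp (lookup F k) ≡ 0 → IsTypeII (lookup F k)

-- the sign character counts the points of a symbol whose scale-1 terms have type II ...
Γ₋-even : ∀ F → EvenUnimodular F → Γˢ χ₋ F ≡ real (+ cards F)
Γ₋-even F even = Γ₋ˢ.factor-exact (λ w → w) exact F (λ k → Γ₋-term (lookup F k) (even k))

-- ... and vanishes on a symbol with a type I term of scale 1
Γ₋-odd-symbol : ∀ F k → exp (lookup F k) ≡ 0 → IsTypeI (lookup F k) → Γˢ χ₋ F ≡ real 0ℤ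
Γ₋-odd-symbol F k exp≡0 I = Γ₋ˢ.factor-zero F k (Γ₋-odd (lookup F k) exp≡0 I)

-- Β₋ counts pairs of points of a symbol without terms of scale 1
Β₋-no-unimodular : ∀ F → (∀ k → ¬ exp (lookup F k) ≡ 0) → Β₋ˢ F ≡ real (+ (cards F ℕ.* cards F))
Β₋-no-unimodular F exp≢0 = Β₋ˢ.factor-exact (λ w → w ℕ.* w) exactSquare F (λ k → Β₋-term (lookup F k) (exp≢0 k))

-- a type II term of scale 1 divides Β₋ by 4 at least
Β₋-hyperbolic-bound : ∀ F i s → lookup F i ≡ term 0 s typeII →
                      Σ[ b ∈ ℕ ] Β₋ˢ F ≡ real (+ b) × 4 ℕ.* b ≤ cards F ℕ.* cards F
Β₋-hyperbolic-bound F i s Fᵢ≡ = quarter (Β₋ˢ.factor-one boundedSquare F i (λ k _ → Β₋-bound (lookup F k)))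
  where
  quarter : Β₋ˢ.Split BoundedSquare F i → Σ[ b ∈ ℕ ] Β₋ˢ F ≡ real (+ b) × 4 ℕ.* b ≤ cards F ℕ.* cards F
  quarter (Z , W , ΒF≡ , cards≡ , b , Z≡b , b≤W²) = 64 ℕ.* b ,
    trans ΒF≡ (trans (cong₂ (λ t z → Β χ₋ ⌊ termGram t ⌋ *ᵢ real z) Fᵢ≡ Z≡b)
                     (trans (cong (_*ᵢ real (+ b)) (Β₋-hyperbolic s)) (trans (real-* (+ 64) (+ b)) (cong real (sym (ℤₚ.pos-* 64 b)))))) ,
    (begin
      4 ℕ.* (64 ℕ.* b)                    ≡⟨ ℕₚ.*-assoc 4 64 b ⟨
      256 ℕ.* b                           ≤⟨ ℕₚ.*-monoʳ-≤ 256 b≤W² ⟩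
      256 ℕ.* (W ℕ.* W)                   ≡⟨ square16 W ⟩
      (16 ℕ.* W) ℕ.* (16 ℕ.* W)           ≡⟨ cong₂ ℕ._*_ cards16 cards16 ⟨
      cards F ℕ.* cards F                 ∎)
    where open ℕₚ.≤-Reasoning
          cards16 : cards F ≡ 16 ℕ.* W
          cards16 = trans cards≡ (cong (λ t → card t ℕ.* W) Fᵢ≡)
          square16 : ∀ W → 256 ℕ.* (W ℕ.* W) ≡ (16 ℕ.* W) ℕ.* (16 ℕ.* W)
          square16 = ℕ-Solver.solve-∀

-- the factor 1^{±2}_II of Γᵢ
hyperbolic-factor : ∀ {t s} Z → t ≡ term 0 s typeII → Γ χᵢ ⌊ termGram t ⌋ *ᵢ real Z ≡ real ((s ◃ 8) ℤ.* Z)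
hyperbolic-factor {s = s} Z refl = trans (cong (_*ᵢ real Z) (Γᵢ-hyperbolic s)) (real-* (s ◃ 8) Z)

-- A symbol whose terms of scale 1 are all of type II, one of them 1^{s2}_II:
-- Γᵢ = s·8·Z with Z = W or |Z| ≤ W/2, where 16·W is the number of points.
Γᵢ-even-hyperbolic : ∀ F i s → EvenUnimodular F → lookup F i ≡ term 0 s typeII →
  Σ[ Z ∈ ℤ ] Σ[ W ∈ ℕ ] Γˢ χᵢ F ≡ real ((s ◃ 8) ℤ.* Z) × cards F ≡ 16 ℕ.* W × WholeOrHalf Z W
Γᵢ-even-hyperbolic F i s even Fᵢ≡ =
  let (Z , W , ΓF≡ , cards≡ , Z~W) = Γᵢˢ.factor-one wholeOrHalf F i (λ k _ → Γᵢ-bound (lookup F k) (even k))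
  in Z , W , trans ΓF≡ (hyperbolic-factor Z Fᵢ≡) , trans cards≡ (cong (λ t → card t ℕ.* W) Fᵢ≡) , Z~W

-- A symbol whose only term of scale 1 is 1^{s2}_II and which has no type I
-- term of scale 2: Γᵢ = s·8·W, where 16·W is the number of points.
Γᵢ-lone-hyperbolic : ∀ F i s → lookup F i ≡ term 0 s typeII →
  (∀ k → ¬ k ≡ i → ¬ exp (lookup F k) ≡ 0) → (∀ k → ¬ (exp (lookup F k) ≡ 1 × IsTypeI (lookup F k))) →
  Σ[ W ∈ ℕ ] Γˢ χᵢ F ≡ real ((s ◃ 8) ℤ.* + W) × cards F ≡ 16 ℕ.* W
Γᵢ-lone-hyperbolic F i s Fᵢ≡ unimodular≡i no-I₁ =
  let (Z , W , ΓF≡ , cards≡ , Z≡W) =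
        Γᵢˢ.factor-one exact F i (λ k k≢i → _ , Γᵢ-term (lookup F k) (unimodular≡i k k≢i) (no-I₁ k) , refl)
  in W , trans ΓF≡ (trans (cong (λ z → Γ χᵢ ⌊ termGram (lookup F i) ⌋ *ᵢ real z) Z≡W) (hyperbolic-factor (+ W) Fᵢ≡)) ,
     trans cards≡ (cong (λ t → card t ℕ.* W) Fᵢ≡)

-- a nonzero number is not at least twice itself
not-multiple : ∀ k n .{{_ : ℕ.NonZero n}} → ¬ (suc (suc k) ℕ.* n ≤ n)
not-multiple k n kn≤n with ℕₚ.*-cancelʳ-≤ (suc (suc k)) 1 n (subst (suc (suc k) ℕ.* n ℕ.≤_) (sym (ℕₚ.*-identityˡ n)) kn≤n)
... | ℕ.s≤s ()

-- if ε·8·Z = -ε·8·W then Z = -W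
opposite-eight : ∀ ε Z W → (ε ◃ 8) ℤ.* Z ≡ (opposite ε ◃ 8) ℤ.* W → Z ≡ ℤ.- W
opposite-eight Sign.+ Z W 8Z≡-8W = ℤₚ.*-cancelˡ-≡ (+ 8) Z (ℤ.- W) (trans 8Z≡-8W (negate W))
  where negate : ∀ W → (ℤ.- + 8) ℤ.* W ≡ + 8 ℤ.* ℤ.- W
        negate = ℤ-Solver.solve-∀
opposite-eight Sign.- Z W -8Z≡8W = ℤₚ.*-cancelˡ-≡ (ℤ.- + 8) Z (ℤ.- W) (trans -8Z≡8W (negate W))
  where negate : ∀ W → + 8 ℤ.* W ≡ (ℤ.- + 8) ℤ.* ℤ.- W
        negate = ℤ-Solver.solve-∀

-- -W is neither W nor of absolute value at most W/2
opposite-not-whole-or-half : ∀ W .{{_ : ℕ.NonZero W}} → ¬ WholeOrHalf (ℤ.- + W) W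
opposite-not-whole-or-half (suc w) (inj₁ ())
opposite-not-whole-or-half W@(suc w) (inj₂ 2W≤W) = not-multiple 0 W 2W≤W

∈-modify : ∀ (F : List Term) f i → f i (lookup F i) ∈ modify F f
∈-modify (t ∷ F) f zero    = here refl
∈-modify (t ∷ F) f (suc i) = there (∈-modify F (λ k → f (suc k)) i)

-- one sign walk on the terms at positions i and j
sign-walk : ∀ F i j → ¬ i ≡ j → (c : SWCase (lookup F i) (lookup F j)) →
            Σ[ F′ ∈ List Term ] Moves F F′ × walk c (lookup F i) ∈ F′
sign-walk F i j i≢j c = modify F walked , signWalk (i , j , i≢j , c , refl) ◅ done ,
  subst (_∈ modify F walked) (cong (λ b → if b ∨ does (i Fin.≟ j) then walk c (lookup F i) else lookup F i)
                                   (dec-true (i Fin.≟ i) refl))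
        (∈-modify F walked i)
  where walked : Fin (length F) → Term → Term
        walked k t = if does (k Fin.≟ i) ∨ does (k Fin.≟ j) then walk c t else t

-- A walk of the first kinds (not case 2) negates the sign of 1^{s2}_II.
negating-walk : ∀ F i j s → lookup F i ≡ term 0 s typeII → ¬ i ≡ j → (c : SWCase (lookup F i) (lookup F j)) →
                walk c (lookup F i) ≡ negSign (lookup F i) →
                Σ[ F′ ∈ List Term ] Moves F F′ × term 0 (opposite s) typeII ∈ F′
negating-walk F i j s Fᵢ≡ i≢j c walk≡neg =
  let (F′ , moves , walked∈F′) = sign-walk F i j i≢j c
  in F′ , moves , subst (_∈ F′) (trans walk≡neg (cong negSign Fᵢ≡)) walked∈F′

-- 1^{s2}_II walks with another term of scale 1 (case 0) ...
flip-with-unimodular : ∀ F i j s → lookup F i ≡ term 0 s typeII → ¬ j ≡ i → exp (lookup F j) ≡ 0 →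
                       Σ[ F′ ∈ List Term ] Moves F F′ × term 0 (opposite s) typeII ∈ F′
flip-with-unimodular F i j s Fᵢ≡ j≢i expⱼ≡0 =
  negating-walk F i j s Fᵢ≡ (λ i≡j → j≢i (sym i≡j)) (case0 (trans (cong exp Fᵢ≡) (sym expⱼ≡0))) refl

-- ... or with a type I term of scale 2 (case 1)
flip-with-scale-two : ∀ F i j s → lookup F i ≡ term 0 s typeII → exp (lookup F j) ≡ 1 → IsTypeI (lookup F j) →
                      Σ[ F′ ∈ List Term ] Moves F F′ × term 0 (opposite s) typeII ∈ F′
flip-with-scale-two F i j s Fᵢ≡ expⱼ≡1 I = negating-walk F i j s Fᵢ≡ i≢j
  (case1 (inj₁ (trans expⱼ≡1 (cong (λ t → 1 ℕ.+ exp t) (sym Fᵢ≡)))) (inj₂ (cong kind Fᵢ≡ , I))) refl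
  where i≢j : ¬ i ≡ j
        i≢j i≡j = ℕₚ.0≢1+n (trans (sym (cong exp Fᵢ≡)) (trans (cong (λ k → exp (lookup F k)) i≡j) expⱼ≡1))

-- Two fine symbols F₀ and F of the same lattice, F₀ containing 1^{ε2}_II.
module SameLattice (ε : Sign) (L : IntegralLattice) (F₀ F : List Term)
                   (fine₀ : FineSymbolFor L F₀) (ε∈F₀ : term 0 ε typeII ∈ F₀) (fine : FineSymbolFor L F) where

  i₀ : Fin (length F₀)
  i₀ = index ε∈F₀

  F₀[i₀] : lookup F₀ i₀ ≡ term 0 ε typeII
  F₀[i₀] = sym (lookup-index ε∈F₀)

  -- by the fine-decomposition condition, all terms of F₀ of scale 1 have type II
  even₀ : EvenUnimodular F₀
  even₀ k exp≡0 = proj₁ fine₀ i₀ k (cong kind F₀[i₀]) (trans exp≡0 (sym (cong exp F₀[i₀])))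

  same-cards : cards F₀ ≡ cards F
  same-cards = ℤₚ.+-injective (real-injective (begin
    real (+ cards F₀) ≡⟨ Γ₁-symbol F₀ ⟨
    Γˢ χ₁ F₀          ≡⟨ Γˢ-invariant L F₀ F fine₀ fine χ₁ ⟩
    Γˢ χ₁ F           ≡⟨ Γ₁-symbol F ⟩
    real (+ cards F)  ∎))
    where open ≡-Reasoning

  -- F has no type I term of scale 1: it would make Γ₋ vanish
  no-odd-unimodular : ∀ k → exp (lookup F k) ≡ 0 → ¬ IsTypeI (lookup F k)
  no-odd-unimodular k exp≡0 I = ℕ.≢-nonZero⁻¹ (cards F₀) {{cards-nonZero F₀}} (ℤₚ.+-injective (real-injective (begin
    real (+ cards F₀) ≡⟨ Γ₋-even F₀ even₀ ⟨
    Γˢ χ₋ F₀          ≡⟨ Γˢ-invariant L F₀ F fine₀ fine χ₋ ⟩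
    Γˢ χ₋ F           ≡⟨ Γ₋-odd-symbol F k exp≡0 I ⟩
    real 0ℤ           ∎)))
    where open ≡-Reasoning

  -- F has a term of scale 1: otherwise Β₋ would be 4 times too large
  some-unimodular : ¬ (∀ k → ¬ exp (lookup F k) ≡ 0)
  some-unimodular none =
    let (b , ΒF₀≡b , 4b≤cards₀²) = Β₋-hyperbolic-bound F₀ i₀ ε F₀[i₀]
        c = cards F
        b≡c² : b ≡ c ℕ.* c
        b≡c² = ℤₚ.+-injective (real-injective (trans (sym ΒF₀≡b) (trans (Β₋ˢ-invariant L F₀ F fine₀ fine) (Β₋-no-unimodular F none))))
    in not-multiple 2 (c ℕ.* c) {{ℕₚ.m*n≢0 c c {{cards-nonZero F}} {{cards-nonZero F}}}}
         (subst₂ (λ b′ c′ → 4 ℕ.* b′ ℕ.≤ c′ ℕ.* c′) b≡c² same-cards 4b≤cards₀²)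

  -- F cannot have 1^{-ε2}_II as its only term of scale 1 and no type I term of scale 2:
  -- Γᵢ would have the wrong sign
  lone-opposite : ∀ i → lookup F i ≡ term 0 (opposite ε) typeII →
                  (∀ k → ¬ k ≡ i → ¬ exp (lookup F k) ≡ 0) →
                  (∀ k → ¬ (exp (lookup F k) ≡ 1 × IsTypeI (lookup F k))) → ⊥
  lone-opposite i F[i] others no-I₁ =
    let (Z , W₀ , ΓF₀≡ , cards₀≡ , Z~W₀) = Γᵢ-even-hyperbolic F₀ i₀ ε even₀ F₀[i₀]
        (W , ΓF≡ , cards≡) = Γᵢ-lone-hyperbolic F i (opposite ε) F[i] others no-I₁
        W₀≡W : W₀ ≡ W
        W₀≡W = ℕₚ.*-cancelˡ-≡ W₀ W 16 (trans (sym cards₀≡) (trans same-cards cards≡))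
        Z≡-W : Z ≡ ℤ.- + W
        Z≡-W = opposite-eight ε Z (+ W) (real-injective (trans (sym ΓF₀≡) (trans (Γˢ-invariant L F₀ F fine₀ fine χᵢ) ΓF≡)))
    in opposite-not-whole-or-half W {{ℕₚ.m*n≢0⇒n≢0 16 {{subst ℕ.NonZero cards≡ (cards-nonZero F)}}}}
         (subst₂ WholeOrHalf Z≡-W W₀≡W Z~W₀)

-- being of type I is decidable
isTypeI? : ∀ t → Dec (IsTypeI t)
isTypeI? (term _ _ typeII)    = no λ ()
isTypeI? (term _ _ (typeI l)) = yes (l , refl)

-- a term of scale 1 that is not of type I is 1^{±2}_II
unimodular-typeII : ∀ t → exp t ≡ 0 → ¬ IsTypeI t → t ≡ term 0 (sign t) typeII
unimodular-typeII (term 0 s typeII)    _ _  = refl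
unimodular-typeII (term 0 s (typeI l)) _ ¬I = ⊥-elim (¬I (l , refl))

-- there are only two signs
≢⇒opposite : ∀ {s ε : Sign} → ¬ s ≡ ε → s ≡ opposite ε
≢⇒opposite {Sign.+} {Sign.+} s≢ε = ⊥-elim (s≢ε refl)
≢⇒opposite {Sign.+} {Sign.-} _   = refl
≢⇒opposite {Sign.-} {Sign.+} _   = refl
≢⇒opposite {Sign.-} {Sign.-} s≢ε = ⊥-elim (s≢ε refl)

-- The theorem: find a term 1^{s2}_II in F (some-unimodular, no-odd-unimodular) and,
-- if s ≠ ε, flip its sign by one sign walk with a partner (lone-opposite).
lemma5p4 : (ε : Sign) (L : IntegralLattice) →
    (Σ[ F₀ ∈ List Term ] FineSymbolFor L F₀ × term 0 ε typeII ∈ F₀) →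
    (F : List Term) → FineSymbolFor L F →
    Σ[ F′ ∈ List Term ] Moves F F′ × term 0 ε typeII ∈ F′
lemma5p4 ε L (F₀ , fine₀ , ε∈F₀) F fine = with-unimodular (Finₚ.any? (λ k → exp (lookup F k) ℕ.≟ 0))
  where
  open SameLattice ε L F₀ F fine₀ ε∈F₀ fine

  Goal : Set
  Goal = Σ[ F′ ∈ List Term ] Moves F F′ × term 0 ε typeII ∈ F′

  -- a flipped 1^{-ε2}_II is 1^{ε2}_II
  ε-after-flip : Σ[ F′ ∈ List Term ] Moves F F′ × term 0 (opposite (opposite ε)) typeII ∈ F′ → Goal
  ε-after-flip (F′ , moves , flipped∈F′) =
    F′ , moves , subst (λ s → term 0 s typeII ∈ F′) (Signₚ.opposite-involutive ε) flipped∈F′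

  -- F has 1^{-ε2}_II at position i: walk it with another term of scale 1 or with
  -- a type I term of scale 2; by lone-opposite one of them exists
  walk-partner : ∀ i → lookup F i ≡ term 0 (opposite ε) typeII →
                 Dec (Σ[ j ∈ Fin (length F) ] ¬ j ≡ i × exp (lookup F j) ≡ 0) →
                 Dec (Σ[ j ∈ Fin (length F) ] exp (lookup F j) ≡ 1 × IsTypeI (lookup F j)) → Goal
  walk-partner i F[i] (yes (j , j≢i , expⱼ≡0)) _ = ε-after-flip (flip-with-unimodular F i j (opposite ε) F[i] j≢i expⱼ≡0)
  walk-partner i F[i] (no _) (yes (j , expⱼ≡1 , I)) = ε-after-flip (flip-with-scale-two F i j (opposite ε) F[i] expⱼ≡1 I)
  walk-partner i F[i] (no others) (no no-I₁) =
    ⊥-elim (lone-opposite i F[i] (λ k k≢i exp≡0 → others (k , k≢i , exp≡0)) (λ k I₁ → no-I₁ (k , I₁)))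

  -- F has 1^{s2}_II at position i; done if s = ε
  fix-sign : ∀ i → lookup F i ≡ term 0 (sign (lookup F i)) typeII → Dec (sign (lookup F i) ≡ ε) → Goal
  fix-sign i F[i] (yes s≡ε) = F , done , subst (_∈ F) (trans F[i] (cong (λ s → term 0 s typeII) s≡ε)) (∈-lookup i)
  fix-sign i F[i] (no s≢ε)  =
    walk-partner i (trans F[i] (cong (λ s → term 0 s typeII) (≢⇒opposite s≢ε)))
      (Finₚ.any? (λ k → ¬? (k Fin.≟ i) ×-dec exp (lookup F k) ℕ.≟ 0))
      (Finₚ.any? (λ k → exp (lookup F k) ℕ.≟ 1 ×-dec isTypeI? (lookup F k)))

  -- F has a term of scale 1, necessarily of type II
  with-unimodular : Dec (Σ[ i ∈ Fin (length F) ] exp (lookup F i) ≡ 0) → Goal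
  with-unimodular (no none)         = ⊥-elim (some-unimodular (λ k exp≡0 → none (k , exp≡0)))
  with-unimodular (yes (i , exp≡0)) =
    fix-sign i (unimodular-typeII (lookup F i) exp≡0 (no-odd-unimodular i exp≡0)) (sign (lookup F i) Data.Sign.≟ ε)
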